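{- There exists a Boolean algebra $\mathfrak B$ which is approximable but does not carry any strictly positive separable finitely additive measure.
   Context: A (finitely additive) measure on a Boolean algebra $\mathfrak B$ is a function $\mu:\mathfrak B\to[0,\infty)$ with $\mu(a\vee b)=\mu(a)+\mu(b)$ whenever $a\wedge b=0$; it is a probability if $\mu(1)=1$ and strictly positive if $\mu(a)>0$ for all $a\neq0$. $\mathfrak B$ is approximable if there is a sequence $\langle\mu_n:n<\omega\rangle$ of finitely additive probability measures on $\mathfrak B$ such that for every $a\in\mathfrak B\setminus\{0\}$ there is $n$ with $\mu_n(a)>1/2$. A strictly positive measure $\mu$ on $\mathfrak B$ is separable if the metric space $(\mathfrak B,d_\mu)$, where $d_\mu(a,b)=\mu(a\,\triangle\,b)$, has a countable dense subset. -}

module Defs where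

open import Level using (Level; _⊔_)
open import Algebra.Lattice.Bundles using (BooleanAlgebra)
open import Data.Nat as ℕ using (ℕ)
import Data.Nat.Properties as ℕ
open import Data.Product using (Σ-syntax; ∃-syntax; _×_; _,_)
open import Data.Rational as ℚ using (ℚ; 0ℚ; 1ℚ; ½; ∣_∣)
import Data.Rational.Properties as ℚ
open import Data.Rational.Solver using (module +-*-Solver)
open import Relation.Binary.PropositionalEquality using (_≡_; refl; sym; trans; cong; subst)
open import Relation.Nullary using (¬_)

-- Cantor's construction of the real numbers: Cauchy sequences of rationals,
-- with _≃_ as equality. Under excluded middle this is the usual complete
-- ordered field.

IsCauchy : (ℕ → ℚ) → Set
IsCauchy s = ∀ ε → 0ℚ ℚ.< ε →
  ∃[ N ] (∀ m n → N ℕ.≤ m → N ℕ.≤ n → ∣ s m ℚ.- s n ∣ ℚ.< ε)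

record ℝ : Set where
  constructor mkℝ
  field
    seq    : ℕ → ℚ
    cauchy : IsCauchy seq

open ℝ public

infix 4 _≃_ _<ᴿ_ _≤ᴿ_

_≃_ : ℝ → ℝ → Set
x ≃ y = ∀ ε → 0ℚ ℚ.< ε →
  ∃[ N ] (∀ n → N ℕ.≤ n → ∣ seq x n ℚ.- seq y n ∣ ℚ.< ε)

-- The gap ε is needed: termwise strict inequality can hold between
-- sequences with the same limit.
_<ᴿ_ : ℝ → ℝ → Set
x <ᴿ y = ∃[ ε ] (0ℚ ℚ.< ε ×
  ∃[ N ] (∀ n → N ℕ.≤ n → ε ℚ.< seq y n ℚ.- seq x n))

_≤ᴿ_ : ℝ → ℝ → Set
x ≤ᴿ y = ¬ (y <ᴿ x)

fromℚ : ℚ → ℝ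
fromℚ q = mkℝ (λ _ → q) λ ε 0<ε →
  0 , λ _ _ _ _ → subst (ℚ._< ε) (sym (cong ∣_∣ (ℚ.+-inverseʳ q))) 0<ε

0ᴿ ½ᴿ 1ᴿ : ℝ
0ᴿ = fromℚ 0ℚ
½ᴿ = fromℚ ½
1ᴿ = fromℚ 1ℚ

private
  half-pos : ∀ ε → 0ℚ ℚ.< ε → 0ℚ ℚ.< ½ ℚ.* ε
  half-pos ε 0<ε =
    subst (ℚ._< ½ ℚ.* ε) (ℚ.*-zeroʳ ½) (ℚ.*-monoʳ-<-pos ½ 0<ε)

  half+half : ∀ ε → ½ ℚ.* ε ℚ.+ ½ ℚ.* ε ≡ ε
  half+half ε = trans (sym (ℚ.*-distribʳ-+ ε ½ ½)) (ℚ.*-identityˡ ε)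

  interchange : ∀ a b c d → (a ℚ.- c) ℚ.+ (b ℚ.- d) ≡ (a ℚ.+ b) ℚ.- (c ℚ.+ d)
  interchange = solve 4
    (λ a b c d → (a :- c) :+ (b :- d) := (a :+ b) :- (c :+ d)) refl
    where open +-*-Solver

infixl 6 _+ᴿ_

_+ᴿ_ : ℝ → ℝ → ℝ
mkℝ s cs +ᴿ mkℝ t ct = mkℝ (λ n → s n ℚ.+ t n) cauchy-sum
  where
  cauchy-sum : IsCauchy (λ n → s n ℚ.+ t n)
  cauchy-sum ε 0<ε with cs (½ ℚ.* ε) (half-pos ε 0<ε) | ct (½ ℚ.* ε) (half-pos ε 0<ε)
  ... | M , hs | N , ht = M ℕ.⊔ N , λ m n p q → begin-strict
      ∣ (s m ℚ.+ t m) ℚ.- (s n ℚ.+ t n) ∣   ≡⟨ cong ∣_∣ (interchange (s m) (t m) (s n) (t n)) ⟨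
      ∣ (s m ℚ.- s n) ℚ.+ (t m ℚ.- t n) ∣   ≤⟨ ℚ.∣p+q∣≤∣p∣+∣q∣ (s m ℚ.- s n) (t m ℚ.- t n) ⟩
      ∣ s m ℚ.- s n ∣ ℚ.+ ∣ t m ℚ.- t n ∣
        <⟨ ℚ.+-mono-< (hs m n (ℕ.m⊔n≤o⇒m≤o M N p) (ℕ.m⊔n≤o⇒m≤o M N q))
                      (ht m n (ℕ.m⊔n≤o⇒n≤o M N p) (ℕ.m⊔n≤o⇒n≤o M N q)) ⟩
      ½ ℚ.* ε ℚ.+ ½ ℚ.* ε                   ≡⟨ half+half ε ⟩
      ε                                     ∎
    where open ℚ.≤-Reasoning

module _ {c ℓ : Level} (𝔅 : BooleanAlgebra c ℓ) where

  open BooleanAlgebra 𝔅 using (Carrier; _≈_; _≉_; _∨_; _∧_; ⊤; ⊥) renaming (¬_ to ∁)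

  record Measure : Set (c ⊔ ℓ) where
    field
      μ        : Carrier → ℝ
      μ-cong   : ∀ {a b} → a ≈ b → μ a ≃ μ b
      μ-nonneg : ∀ a → 0ᴿ ≤ᴿ μ a
      μ-add    : ∀ a b → a ∧ b ≈ ⊥ → μ (a ∨ b) ≃ μ a +ᴿ μ b

  open Measure

  IsProbability : Measure → Set
  IsProbability ν = μ ν ⊤ ≃ 1ᴿ

  StrictlyPositive : Measure → Set (c ⊔ ℓ)
  StrictlyPositive ν = ∀ a → a ≉ ⊥ → 0ᴿ <ᴿ μ ν a

  Approximable : Set (c ⊔ ℓ)
  Approximable = Σ[ ν ∈ (ℕ → Measure) ]
    (∀ n → IsProbability (ν n)) ×
    (∀ a → a ≉ ⊥ → ∃[ n ] (½ᴿ <ᴿ μ (ν n) a))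

  infixl 6 _△_

  _△_ : Carrier → Carrier → Carrier
  a △ b = (a ∧ ∁ b) ∨ (b ∧ ∁ a)

  dist : Measure → Carrier → Carrier → ℝ
  dist ν a b = μ ν (a △ b)

  -- The space contains ⊥, so a dense subset is nonempty, and a nonempty
  -- countable subset is the range of a sequence d, possibly with repetitions.
  Separable : Measure → Set c
  Separable ν = Σ[ d ∈ (ℕ → Carrier) ]
    (∀ a ε → 0ᴿ <ᴿ ε → ∃[ n ] (dist ν a (d n) <ᴿ ε))

{-# OPTIONS --safe #-}
-- The algebra is generated by elements a_ξ (ξ a binary sequence; point ξ below) and b_T (family T
-- below), where T is a sequence of finite blocks of binary sequences of rapidly growing sizes m_k.
-- The only relations force b_T, for every k such that the k-th block of T has distinct entries, to
-- lie below "the a_ξ with ξ in that block are not all equal".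
--
-- If ν is strictly positive and separable then, by pigeonhole, for every k there are m_k distinct ξ
-- whose a_ξ all lie within 2^-(m_k + k) of one element of a countable dense set. Taking these as
-- the k-th block of T gives ν(b_T) ≤ 2^-k for all k, although b_T ≠ 0.
--
-- For approximability let the bits a_ξ be F(a_ξ) flipped independently with probability δ, and let
-- b_T hold if F(b_T) does and no block of T is violated. Given a ≠ 0 and a valuation satisfying it,
-- let F copy that valuation on the generators of a and on their first K blocks, and choose δ so small
-- that probably none of these finitely many bits is flipped; the later blocks are so large that
-- probably none of them is violated. Countably many F suffice, because finitely many binary sequences
-- are separated by finitely many of their digits, so that F may be read off a finite binary tree.
-- No infinite product measure is needed: at level j the random bits sit at the leaves of a
-- binary tree of depth j, only the first j blocks count, and a block counts only if its entries are
-- separated by their first j digits. The resulting rational probabilities form a Cauchy sequence.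
module Submission where

open import Algebra.Bundles using (CommutativeRing)
open import Algebra.Lattice.Bundles using (BooleanAlgebra)
import Algebra.Properties.Semiring.Exp as Exp
import Algebra.Properties.Semiring.Mult as Mult
open import Axiom.ExcludedMiddle using (ExcludedMiddle)
open import Axiom.Extensionality.Propositional using (Extensionality)
open import Data.Bool using (Bool; true; false; if_then_else_; not; _∧_; _∨_; _xor_)
open import Data.Bool.ListAction using (all)
import Data.Bool.Properties as 𝔹
open import Data.Empty using (⊥-elim)
open import Data.Integer as ℤ using (-[1+_]; +≤+; +<+) renaming (+_ to pos)
import Data.Integer.Properties as ℤ
open import Data.List using (List; []; _∷_; [_]; _++_; length; map; concatMap; applyUpTo)
open import Data.List.Membership.Propositional using (_∈_)
open import Data.List.Properties using (length-applyUpTo; length-++)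
open import Data.List.Relation.Unary.All as All using (All; []; _∷_)
import Data.List.Relation.Unary.All.Properties as All
open import Data.List.Relation.Unary.AllPairs as AllPairs using (AllPairs; []; _∷_)
open import Data.List.Relation.Unary.Any using (here; there)
open import Data.Nat as ℕ using (ℕ; zero; suc)
import Data.Nat.Properties as ℕ
open import Data.Product using (Σ-syntax; ∃-syntax; _×_; _,_; proj₁; proj₂)
open import Data.Rational using (ℚ; mkℚ; 0ℚ; 1ℚ; ½; _+_; _*_; _-_; -_; 1/_; _≤_; _<_; ∣_∣; *<*; *≤*; NonZero; Positive; positive; nonNegative; toℚᵘ)
open import Data.Rational.Properties hiding (_≟_)
open import Data.Rational.Solver using (module +-*-Solver)
open import Data.Rational.Unnormalised as ℚᵘ using (mkℚᵘ; *≡*)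
import Data.Rational.Unnormalised.Properties as ℚᵘ
open import Data.Sum using (_⊎_; inj₁; inj₂; [_,_]′)
open import Function using (_∘_)
open import Level using (0ℓ)
open import Relation.Binary.PropositionalEquality using (_≡_; _≢_; refl; sym; trans; cong; cong₂; subst; subst₂; module ≡-Reasoning)
open import Relation.Nullary using (¬_; Dec; yes; no; contradiction; ⌊_⌋)
open import Relation.Nullary.Decidable using (decidable-stable)
open import Defs

-- Rational estimates

ℚ-semiring = CommutativeRing.semiring +-*-commutativeRing

open Mult ℚ-semiring using (×1-homo-*) renaming (_×_ to _·_)
open Exp ℚ-semiring using (_^_; ^-homo-*)

ι : ℕ → ℚ
ι n = n · 1ℚ

0≤1 : 0ℚ ≤ 1ℚ
0≤1 = *≤* (+≤+ ℕ.z≤n)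

0≤½ : 0ℚ ≤ ½
0≤½ = *≤* (+≤+ ℕ.z≤n)

½<1 : ½ < 1ℚ
½<1 = *<* (+<+ (ℕ.s≤s (ℕ.s≤s ℕ.z≤n)))

*-mono-left : ∀ {r p q} → 0ℚ ≤ r → p ≤ q → r * p ≤ r * q
*-mono-left {r} 0≤r = *-monoˡ-≤-nonNeg r ⦃ nonNegative 0≤r ⦄

*-mono-right : ∀ {r p q} → 0ℚ ≤ r → p ≤ q → p * r ≤ q * r
*-mono-right {r} 0≤r = *-monoʳ-≤-nonNeg r ⦃ nonNegative 0≤r ⦄

0≤+ : ∀ {p q} → 0ℚ ≤ p → 0ℚ ≤ q → 0ℚ ≤ p + q
0≤+ = +-mono-≤

0≤* : ∀ {p q} → 0ℚ ≤ p → 0ℚ ≤ q → 0ℚ ≤ p * q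
0≤* {p} {q} 0≤p 0≤q = subst (_≤ p * q) (*-zeroʳ p) (*-mono-left 0≤p 0≤q)

p≤p+q : ∀ {p q} → 0ℚ ≤ q → p ≤ p + q
p≤p+q {p} {q} 0≤q = subst (_≤ p + q) (+-identityʳ p) (+-monoʳ-≤ p 0≤q)

p≤q+p : ∀ {p q} → 0ℚ ≤ q → p ≤ q + p
p≤q+p {p} {q} 0≤q = subst (_≤ q + p) (+-identityˡ p) (+-monoˡ-≤ p 0≤q)

0≤ι : ∀ n → 0ℚ ≤ ι n
0≤ι zero    = ≤-refl
0≤ι (suc n) = 0≤+ 0≤1 (0≤ι n)

0≤^ : ∀ {q} n → 0ℚ ≤ q → 0ℚ ≤ q ^ n
0≤^ zero    0≤q = 0≤1
0≤^ (suc n) 0≤q = 0≤* 0≤q (0≤^ n 0≤q)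

ι-mono : ∀ {m n} → m ℕ.≤ n → ι m ≤ ι n
ι-mono {_} {n} ℕ.z≤n = 0≤ι n
ι-mono (ℕ.s≤s m≤n) = +-monoʳ-≤ 1ℚ (ι-mono m≤n)

0<½^ : ∀ n → 0ℚ < ½ ^ n
0<½^ zero    = *<* (+<+ (ℕ.s≤s ℕ.z≤n))
0<½^ (suc n) = subst (_< ½ * ½ ^ n) (*-zeroʳ ½) (*-monoʳ-<-pos ½ (0<½^ n))

½^≤1 : ∀ n → ½ ^ n ≤ 1ℚ
½^≤1 zero    = ≤-refl
½^≤1 (suc n) = ≤-trans (*-mono-left 0≤½ (½^≤1 n)) (<⇒≤ ½<1)

ι*½^≤1 : ∀ n → ι n * ½ ^ n ≤ 1ℚ
ι*½^≤1 zero    = *≤* (+≤+ ℕ.z≤n)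
ι*½^≤1 (suc n) = begin
  (1ℚ + ι n) * (½ * ½ ^ n)     ≡⟨ solve 2 (λ i h → (con 1ℚ :+ i) :* (con ½ :* h) := con ½ :* (h :+ i :* h)) refl (ι n) (½ ^ n) ⟩
  ½ * (½ ^ n + ι n * ½ ^ n)    ≤⟨ *-mono-left 0≤½ (+-mono-≤ (½^≤1 n) (ι*½^≤1 n)) ⟩
  ½ * (1ℚ + 1ℚ)                ≡⟨⟩
  1ℚ                           ∎
  where open ≤-Reasoning
        open +-*-Solver

toℚᵘ-ι : ∀ n → toℚᵘ (ι n) ℚᵘ.≃ mkℚᵘ (pos n) 0
toℚᵘ-ι zero    = ℚᵘ.≃-refl
toℚᵘ-ι (suc n) = ℚᵘ.≃-trans (toℚᵘ-homo-+ 1ℚ (ι n))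
  (ℚᵘ.≃-trans (ℚᵘ.+-congʳ (toℚᵘ 1ℚ) (toℚᵘ-ι n))
    (*≡* (cong (λ i → (pos 1 ℤ.+ i) ℤ.* pos 1) (ℤ.*-identityʳ (pos n)))))

-- The numerator serves as the bound, because the denominator is at least 1.
archimedean : ∀ {q} → 0ℚ < q → ∃[ n ] (q ≤ ι n)
archimedean {mkℚ (pos n) d _} 0<q = n , toℚᵘ-cancel-≤
  (ℚᵘ.≤-respʳ-≃ (ℚᵘ.≃-sym (toℚᵘ-ι n))
    (ℚᵘ.*≤* (ℤ.*-monoˡ-≤-nonNeg (pos n) {pos 1} {pos (suc d)} (+≤+ (ℕ.s≤s ℕ.z≤n)))))
archimedean {mkℚ -[1+ _ ] _ _} (*<* ())

-- Any n above 1/ε works, since `ι n * ½ ^ n` is at most 1.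
½^-below : ∀ ε .⦃ _ : Positive ε ⦄ → ∃[ n ] (½ ^ n ≤ ε)
½^-below ε with n , 1/ε≤n ← archimedean (positive⁻¹ (1/_ ε ⦃ pos⇒nonZero ε ⦄) ⦃ 1/pos⇒pos ε ⦄) = n ,
  *-cancelʳ-≤-pos (1/ ε) ⦃ 1/pos⇒pos ε ⦄ (begin
    ½ ^ n * 1/ ε           ≤⟨ *-mono-left (0≤^ n 0≤½) 1/ε≤n ⟩
    ½ ^ n * ι n            ≡⟨ *-comm (½ ^ n) (ι n) ⟩
    ι n * ½ ^ n            ≤⟨ ι*½^≤1 n ⟩
    1ℚ                     ≡⟨ *-inverseʳ ε ⟨
    ε * 1/ ε               ∎)
  where
  open ≤-Reasoning
  instance
    ε-nonZero = pos⇒nonZero ε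

½^-small : ∀ {ε} → 0ℚ < ε → ∃[ k ] (½ ^ k < ε)
½^-small {ε} 0<ε with n , ½^n≤ε ← ½^-below ε ⦃ positive 0<ε ⦄ = suc n , (begin-strict
  ½ ^ suc n              ≤⟨ *-mono-left 0≤½ ½^n≤ε ⟩
  ½ * ε                  <⟨ *-monoˡ-<-pos ε ⦃ positive 0<ε ⦄ ½<1 ⟩
  1ℚ * ε                 ≡⟨ *-identityˡ ε ⟩
  ε                      ∎)
  where open ≤-Reasoning

ι*½^-+≤ : ∀ n k → ι n * ½ ^ (n ℕ.+ k) ≤ ½ ^ k
ι*½^-+≤ n k = begin
  ι n * ½ ^ (n ℕ.+ k)     ≡⟨ cong (ι n *_) (^-homo-* ½ n k) ⟩
  ι n * (½ ^ n * ½ ^ k)   ≡⟨ *-assoc (ι n) (½ ^ n) (½ ^ k) ⟨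
  ι n * ½ ^ n * ½ ^ k     ≤⟨ *-mono-right (0≤^ k 0≤½) (ι*½^≤1 n) ⟩
  1ℚ * ½ ^ k              ≡⟨ *-identityˡ (½ ^ k) ⟩
  ½ ^ k                   ∎
  where open ≤-Reasoning

ι*½^-small : ∀ c {ε} → 0ℚ < ε → ∃[ k ] (ι c * ½ ^ k < ε)
ι*½^-small c 0<ε with k , ½^k<ε ← ½^-small 0<ε = c ℕ.+ k , ≤-<-trans (ι*½^-+≤ c k) ½^k<ε

0≤1- : ∀ {δ} → δ ≤ 1ℚ → 0ℚ ≤ 1ℚ - δ
0≤1- {δ} δ≤1 = subst (_≤ 1ℚ - δ) (+-inverseʳ δ) (+-monoˡ-≤ (- δ) δ≤1)

-- Bernoulli's inequality for 1 / (1 - δ) ≥ 1 + δ, without the division.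
[1-δ]^m*[1+mδ]≤1 : ∀ {δ} m → 0ℚ ≤ δ → δ ≤ 1ℚ → (1ℚ - δ) ^ m * (1ℚ + ι m * δ) ≤ 1ℚ
[1-δ]^m*[1+mδ]≤1 {δ} zero 0≤δ δ≤1 = ≤-reflexive (solve 1 (λ d → con 1ℚ :* (con 1ℚ :+ con 0ℚ :* d) := con 1ℚ) refl δ)
  where open +-*-Solver
[1-δ]^m*[1+mδ]≤1 {δ} (suc m) 0≤δ δ≤1 = begin
  (1ℚ - δ) * X * (1ℚ + (1ℚ + ι m) * δ)
    ≤⟨ p≤p+q (0≤* (0≤^ m (0≤1- δ≤1)) (0≤+ (0≤* 0≤δ 0≤δ) (0≤* (0≤ι m) (0≤* 0≤δ 0≤δ)))) ⟩
  (1ℚ - δ) * X * (1ℚ + (1ℚ + ι m) * δ) + X * (δ * δ + ι m * (δ * δ))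
    ≡⟨ solve 3 (λ d x i → (con 1ℚ :- d) :* x :* (con 1ℚ :+ (con 1ℚ :+ i) :* d) :+ x :* (d :* d :+ i :* (d :* d))
                := x :* (con 1ℚ :+ i :* d)) refl δ X (ι m) ⟩
  X * (1ℚ + ι m * δ)
    ≤⟨ [1-δ]^m*[1+mδ]≤1 m 0≤δ δ≤1 ⟩
  1ℚ ∎
  where
  open ≤-Reasoning
  open +-*-Solver
  X = (1ℚ - δ) ^ m

½^n*2^n : ∀ n → ½ ^ n * ι (2 ℕ.^ n) ≡ 1ℚ
½^n*2^n zero    = refl
½^n*2^n (suc n) = trans (cong (½ ^ suc n *_) (×1-homo-* 2 (2 ℕ.^ n)))
  (trans (solve 2 (λ x y → con ½ :* x :* (con (ι 2) :* y) := x :* y) refl (½ ^ n) (ι (2 ℕ.^ n))) (½^n*2^n n))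
  where open +-*-Solver

-- offset k exceeds by 2 the total size of the blocks before the k-th one, which blockSize k dwarfs.
offset blockSize : ℕ → ℕ
offset zero    = 2
offset (suc k) = offset k ℕ.+ blockSize k
blockSize k = 2 ℕ.^ (3 ℕ.+ k) ℕ.* offset k

offset-mono-+ : ∀ k d → offset k ℕ.≤ offset (d ℕ.+ k)
offset-mono-+ k zero    = ℕ.≤-refl
offset-mono-+ k (suc d) = ℕ.≤-trans (offset-mono-+ k d) (ℕ.m≤m+n _ _)

offset-mono : ∀ {k l} → k ℕ.≤ l → offset k ℕ.≤ offset l
offset-mono {k} {l} k≤l = subst (λ i → offset k ℕ.≤ offset i) (ℕ.m∸n+n≡m k≤l) (offset-mono-+ k (l ℕ.∸ k))

-- Bernoulli bounds the power by 1 / (`blockSize k` δ). The factor `2 ^ (3 + k)` of the block size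
-- supplies the decay, and the factor `offset k`, at least `offset K`, absorbs δ at the price of the
-- constant c.
[1-δ]^blockSize : ∀ {δ c} K k → 0ℚ ≤ δ → δ ≤ 1ℚ → 0ℚ ≤ c → 1ℚ ≤ c * (ι (offset K) * δ) → K ℕ.≤ k →
  (1ℚ - δ) ^ blockSize k ≤ c * ½ ^ (3 ℕ.+ k)
[1-δ]^blockSize {δ} {c} K k 0≤δ δ≤1 0≤c h K≤k = begin
  X                                             ≡⟨ *-identityʳ X ⟨
  X * 1ℚ                                        ≤⟨ *-mono-left 0≤X h ⟩
  X * (c * (ι (offset K) * δ))
    ≤⟨ *-mono-left 0≤X (*-mono-left 0≤c (*-mono-right 0≤δ (ι-mono (offset-mono K≤k)))) ⟩
  X * (c * (m * δ))                             ≡⟨ *-identityʳ _ ⟨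
  X * (c * (m * δ)) * 1ℚ                        ≡⟨ cong (X * (c * (m * δ)) *_) (½^n*2^n (3 ℕ.+ k)) ⟨
  X * (c * (m * δ)) * (h₂ * t)
    ≡⟨ solve 6 (λ x c m d h t → x :* (c :* (m :* d)) :* (h :* t) := c :* h :* (x :* (t :* m :* d))) refl X c m δ h₂ t ⟩
  c * h₂ * (X * (t * m * δ))
    ≡⟨ cong (λ z → c * h₂ * (X * (z * δ))) (×1-homo-* (2 ℕ.^ (3 ℕ.+ k)) (offset k)) ⟨
  c * h₂ * (X * (ι (blockSize k) * δ))
    ≤⟨ *-mono-left 0≤ch (*-mono-left 0≤X (p≤q+p 0≤1)) ⟩
  c * h₂ * (X * (1ℚ + ι (blockSize k) * δ))
    ≤⟨ *-mono-left 0≤ch ([1-δ]^m*[1+mδ]≤1 (blockSize k) 0≤δ δ≤1) ⟩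
  c * h₂ * 1ℚ                                   ≡⟨ *-identityʳ (c * h₂) ⟩
  c * h₂                                        ∎
  where
  open ≤-Reasoning
  open +-*-Solver
  X = (1ℚ - δ) ^ blockSize k
  m = ι (offset k)
  t = ι (2 ℕ.^ (3 ℕ.+ k))
  h₂ = ½ ^ (3 ℕ.+ k)
  0≤X = 0≤^ (blockSize k) (0≤1- δ≤1)
  0≤ch = 0≤* 0≤c (0≤^ (3 ℕ.+ k) 0≤½)

-- Finite sums, and independent random bits on a binary tree

sumFrom : (ℕ → ℚ) → ℕ → ℕ → ℚ
sumFrom f k zero    = 0ℚ
sumFrom f k (suc d) = f k + sumFrom f (suc k) d

sumList : ∀ {A : Set} → (A → ℚ) → List A → ℚ
sumList f []       = 0ℚ
sumList f (x ∷ xs) = f x + sumList f xs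

-- One bit for each of the 2^j initial segments of length j; a stream selects its leaf by its first
-- j digits.
Tree : ℕ → Set
Tree zero    = Bool
Tree (suc j) = Tree j × Tree j

Stream : Set
Stream = ℕ → Bool

tail : Stream → Stream
tail ξ i = ξ (suc i)

get : ∀ {j} → Tree j → Stream → Bool
get {zero}  b       ξ = b
get {suc j} (l , r) ξ = if ξ 0 then get r (tail ξ) else get l (tail ξ)

set : ∀ {j} → Tree j → Stream → Bool → Tree j
set {zero}  b       ξ c = c
set {suc j} (l , r) ξ c = if ξ 0 then (l , set r (tail ξ) c) else (set l (tail ξ) c , r)

module Expectation (δ : ℚ) (0≤δ : 0ℚ ≤ δ) (δ≤1 : δ ≤ 1ℚ) where

  E₀ : (Bool → ℚ) → ℚ
  E₀ φ = (1ℚ - δ) * φ false + δ * φ true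

  -- Expectation when the leaves are independent and each is `true` with probability δ; the nesting
  -- over subtrees is the product measure.
  E : ∀ j → (Tree j → ℚ) → ℚ
  E zero    φ = E₀ φ
  E (suc j) φ = E j λ l → E j λ r → φ (l , r)

  E₀-cong : ∀ {φ ψ} → (∀ b → φ b ≡ ψ b) → E₀ φ ≡ E₀ ψ
  E₀-cong eq = cong₂ (λ x y → (1ℚ - δ) * x + δ * y) (eq false) (eq true)

  E-cong : ∀ j {φ ψ} → (∀ t → φ t ≡ ψ t) → E j φ ≡ E j ψ
  E-cong zero    eq = E₀-cong eq
  E-cong (suc j) eq = E-cong j λ l → E-cong j λ r → eq (l , r)

  E₀-mono : ∀ {φ ψ} → (∀ b → φ b ≤ ψ b) → E₀ φ ≤ E₀ ψ
  E₀-mono le = +-mono-≤ (*-mono-left (0≤1- δ≤1) (le false)) (*-mono-left 0≤δ (le true))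

  E-mono : ∀ j {φ ψ} → (∀ t → φ t ≤ ψ t) → E j φ ≤ E j ψ
  E-mono zero    le = E₀-mono le
  E-mono (suc j) le = E-mono j λ l → E-mono j λ r → le (l , r)

  E-+ : ∀ j φ ψ → E j (λ t → φ t + ψ t) ≡ E j φ + E j ψ
  E-+ zero φ ψ = solve 6 (λ p q a b c d → p :* (a :+ b) :+ q :* (c :+ d) := (p :* a :+ q :* c) :+ (p :* b :+ q :* d))
    refl (1ℚ - δ) δ (φ false) (ψ false) (φ true) (ψ true)
    where open +-*-Solver
  E-+ (suc j) φ ψ = trans (E-cong j λ l → E-+ j (λ r → φ (l , r)) (λ r → ψ (l , r)))
    (E-+ j (λ l → E j λ r → φ (l , r)) (λ l → E j λ r → ψ (l , r)))

  E-* : ∀ j c φ → E j (λ t → c * φ t) ≡ c * E j φ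
  E-* zero c φ = solve 5 (λ p q c a b → p :* (c :* a) :+ q :* (c :* b) := c :* (p :* a :+ q :* b))
    refl (1ℚ - δ) δ c (φ false) (φ true)
    where open +-*-Solver
  E-* (suc j) c φ = trans (E-cong j λ l → E-* j c (λ r → φ (l , r))) (E-* j c (λ l → E j λ r → φ (l , r)))

  E-const : ∀ j c → E j (λ _ → c) ≡ c
  E-const zero c = solve 2 (λ d c → (con 1ℚ :- d) :* c :+ d :* c := c) refl δ c
    where open +-*-Solver
  E-const (suc j) c = trans (E-cong j λ _ → E-const j c) (E-const j c)

  E-swap : ∀ j (φ : Bool → Tree j → ℚ) → E j (λ t → E₀ λ c → φ c t) ≡ E₀ λ c → E j (φ c)
  E-swap j φ = trans (E-+ j _ _) (cong₂ _+_ (E-* j (1ℚ - δ) (φ false)) (E-* j δ (φ true)))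

  -- Independence enters the proof in this form: the bit at the leaf of ξ may be drawn separately
  -- and then held fixed while the rest of the tree is averaged.
  E-resample : ∀ j φ ξ → E j φ ≡ E₀ λ c → E j λ t → φ (set t ξ c)
  E-resample zero φ ξ = E₀-cong λ c → sym (E-const zero (φ c))
  E-resample (suc j) φ ξ with ξ 0
  ... | false = E-resample j (λ l → E j λ r → φ (l , r)) (tail ξ)
  ... | true  = trans (E-cong j λ l → E-resample j (λ r → φ (l , r)) (tail ξ))
                      (E-swap j λ c l → E j λ r → φ (l , set r (tail ξ) c))

  E-sumList : ∀ j {A : Set} (f : A → Tree j → ℚ) b → (∀ x → E j (f x) ≤ b) →
    ∀ xs → E j (λ t → sumList (λ x → f x t) xs) ≤ ι (length xs) * b
  E-sumList j f b le [] = ≤-reflexive (trans (E-const j 0ℚ) (sym (*-zeroˡ b)))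
  E-sumList j f b le (x ∷ xs) = begin
    E j (λ t → f x t + sumList (λ x → f x t) xs)          ≡⟨ E-+ j (f x) _ ⟩
    E j (f x) + E j (λ t → sumList (λ x → f x t) xs)      ≤⟨ +-mono-≤ (le x) (E-sumList j f b le xs) ⟩
    b + ι (length xs) * b                                 ≡⟨ solve 2 (λ b i → b :+ i :* b := (con 1ℚ :+ i) :* b) refl b (ι (length xs)) ⟩
    ι (length (x ∷ xs)) * b                               ∎
    where open ≤-Reasoning
          open +-*-Solver

  -- A geometric tail: the first term takes half of the bound and the remaining terms together take
  -- the other half, whatever d is.
  E-sumFrom : ∀ j (f : ℕ → Tree j → ℚ) c K → (∀ k → K ℕ.≤ k → E j (f k) ≤ c * ½ ^ (2 ℕ.+ k)) → 0ℚ ≤ c →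
    ∀ d → E j (λ t → sumFrom (λ k → f k t) K d) ≤ c * ½ ^ (1 ℕ.+ K)
  E-sumFrom j f c K le 0≤c zero = ≤-trans (≤-reflexive (E-const j 0ℚ)) (0≤* 0≤c (0≤^ (1 ℕ.+ K) 0≤½))
  E-sumFrom j f c K le 0≤c (suc d) = begin
    E j (λ t → f K t + sumFrom (λ k → f k t) (suc K) d)   ≡⟨ E-+ j (f K) _ ⟩
    E j (f K) + E j (λ t → sumFrom (λ k → f k t) (suc K) d)
      ≤⟨ +-mono-≤ (le K ℕ.≤-refl) (E-sumFrom j f c (suc K) (λ k K<k → le k (ℕ.<⇒≤ K<k)) 0≤c d) ⟩
    c * ½ ^ (2 ℕ.+ K) + c * ½ ^ (2 ℕ.+ K)
      ≡⟨ solve 2 (λ c h → c :* (con ½ :* h) :+ c :* (con ½ :* h) := c :* h) refl c (½ ^ (1 ℕ.+ K)) ⟩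
    c * ½ ^ (1 ℕ.+ K)                                     ∎
    where open ≤-Reasoning
          open +-*-Solver

-- The Boolean algebra

-- Levels j approximate the intended object. Equations of the algebra, separation of finitely many
-- streams and bounds on probabilities are only asked to hold from some level on.
Eventually : (ℕ → Set) → Set
Eventually P = ∃[ J ] (∀ j → J ℕ.≤ j → P j)

always : ∀ {P : ℕ → Set} → (∀ j → P j) → Eventually P
always p = 0 , λ j _ → p j

from : ∀ J → Eventually (J ℕ.≤_)
from J = J , λ _ J≤j → J≤j

ev-map : ∀ {P Q : ℕ → Set} → (∀ {j} → P j → Q j) → Eventually P → Eventually Q
ev-map f (J , p) = J , λ j J≤j → f (p j J≤j)

ev-zip : ∀ {P Q R : ℕ → Set} → (∀ {j} → P j → Q j → R j) → Eventually P → Eventually Q → Eventually R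
ev-zip f (J , p) (K , q) = J ℕ.⊔ K , λ j le → f (p j (ℕ.m⊔n≤o⇒m≤o J K le)) (q j (ℕ.m⊔n≤o⇒n≤o J K le))

ev-All : ∀ {A : Set} {P : ℕ → A → Set} → (∀ x → Eventually λ j → P j x) → ∀ xs → Eventually λ j → All (P j) xs
ev-All p []       = always λ _ → []
ev-All p (x ∷ xs) = ev-zip _∷_ (p x) (ev-All p xs)

ev-AllPairs : ∀ {A : Set} {R : ℕ → A → A → Set} → (∀ x y → Eventually λ j → R j x y) → ∀ xs → Eventually λ j → AllPairs (R j) xs
ev-AllPairs p []       = always λ _ → []
ev-AllPairs p (x ∷ xs) = ev-zip _∷_ (ev-All (p x) xs) (ev-AllPairs p xs)

ev-below : ∀ {P : ℕ → ℕ → Set} → (∀ k → Eventually λ j → P j k) → ∀ K → Eventually λ j → ∀ k → k ℕ.< K → P j k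
ev-below p zero    = always λ _ _ ()
ev-below {P} p (suc K) = ev-zip (λ {j} → step {j}) (p K) (ev-below p K)
  where
  step : ∀ {j} → P j K → (∀ k → k ℕ.< K → P j k) → ∀ k → k ℕ.< suc K → P j k
  step {j} pK h k (ℕ.s≤s k≤K) with ℕ.m≤n⇒m<n∨m≡n k≤K
  ... | inj₁ k<K  = h k k<K
  ... | inj₂ refl = pK

-- Exactly the condition that ξ and η select different leaves of a tree of depth j.
Sep : ℕ → Stream → Stream → Set
Sep j ξ η = ∃[ i ] (i ℕ.< j × ξ i ≢ η i)

Sep-mono : ∀ {j k ξ η} → j ℕ.≤ k → Sep j ξ η → Sep k ξ η
Sep-mono j≤k (i , i<j , ne) = i , ℕ.≤-trans i<j j≤k , ne

get-set-≡ : ∀ {j} (t : Tree j) ξ c → get (set t ξ c) ξ ≡ c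
get-set-≡ {zero}  t       ξ c = refl
get-set-≡ {suc j} (l , r) ξ c with ξ 0
... | true  = get-set-≡ r (tail ξ) c
... | false = get-set-≡ l (tail ξ) c

get-set-≢ : ∀ {j} (t : Tree j) {ξ η} c → Sep j ξ η → get (set t ξ c) η ≡ get t η
get-set-≢ {suc j} (l , r) {ξ} {η} c (zero , _ , ne) with ξ 0 | η 0
... | true  | true  = contradiction refl ne
... | true  | false = refl
... | false | true  = refl
... | false | false = contradiction refl ne
get-set-≢ {suc j} (l , r) {ξ} {η} c (suc i , ℕ.s≤s i<j , ne) with ξ 0 | η 0
... | true  | true  = get-set-≢ r c (i , i<j , ne)
... | true  | false = refl
... | false | true  = refl
... | false | false = get-set-≢ l c (i , i<j , ne)

data Gen : Set where
  point  : Stream → Gen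
  family : (ℕ → ℕ → Stream) → Gen

infixr 7 _⟨∧⟩_
infixr 6 _⟨∨⟩_

data Formula : Set where
  var         : Gen → Formula
  ⟨⊤⟩ ⟨⊥⟩     : Formula
  _⟨∧⟩_ _⟨∨⟩_ : Formula → Formula → Formula
  ⟨¬⟩_        : Formula → Formula

eval : (Gen → Bool) → Formula → Bool
eval v (var g)   = v g
eval v ⟨⊤⟩       = true
eval v ⟨⊥⟩       = false
eval v (φ ⟨∧⟩ ψ) = eval v φ ∧ eval v ψ
eval v (φ ⟨∨⟩ ψ) = eval v φ ∨ eval v ψ
eval v (⟨¬⟩ φ)   = not (eval v φ)

vars : Formula → List Gen
vars (var g)   = [ g ]
vars ⟨⊤⟩       = []
vars ⟨⊥⟩       = []
vars (φ ⟨∧⟩ ψ) = vars φ ++ vars ψ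
vars (φ ⟨∨⟩ ψ) = vars φ ++ vars ψ
vars (⟨¬⟩ φ)   = vars φ

eval-cong : ∀ φ {v w} → All (λ g → v g ≡ w g) (vars φ) → eval v φ ≡ eval w φ
eval-cong (var g) (eq ∷ []) = eq
eval-cong ⟨⊤⟩ _ = refl
eval-cong ⟨⊥⟩ _ = refl
eval-cong (φ ⟨∧⟩ ψ) eqs = cong₂ _∧_ (eval-cong φ (All.++⁻ˡ (vars φ) eqs)) (eval-cong ψ (All.++⁻ʳ (vars φ) eqs))
eval-cong (φ ⟨∨⟩ ψ) eqs = cong₂ _∨_ (eval-cong φ (All.++⁻ˡ (vars φ) eqs)) (eval-cong ψ (All.++⁻ʳ (vars φ) eqs))
eval-cong (⟨¬⟩ φ) eqs = cong not (eval-cong φ eqs)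

ind : Bool → ℚ
ind true  = 1ℚ
ind false = 0ℚ

0≤ind : ∀ b → 0ℚ ≤ ind b
0≤ind true  = 0≤1
0≤ind false = ≤-refl

ind≤1 : ∀ b → ind b ≤ 1ℚ
ind≤1 true  = ≤-refl
ind≤1 false = 0≤1

0≤sumList : ∀ {A : Set} {f : A → ℚ} → (∀ x → 0ℚ ≤ f x) → ∀ xs → 0ℚ ≤ sumList f xs
0≤sumList 0≤f []       = ≤-refl
0≤sumList 0≤f (x ∷ xs) = 0≤+ (0≤f x) (0≤sumList 0≤f xs)

0≤sumFrom : ∀ {f : ℕ → ℚ} → (∀ k → 0ℚ ≤ f k) → ∀ K d → 0ℚ ≤ sumFrom f K d
0≤sumFrom 0≤f K zero    = ≤-refl
0≤sumFrom 0≤f K (suc d) = 0≤+ (0≤f K) (0≤sumFrom 0≤f (suc K) d)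

-- Each failure of P is charged at least 1. Probabilities of failure can then be bounded by expected
-- costs.
All⊎1≤sumList : ∀ {A : Set} {P : A → Set} {f : A → ℚ} → (∀ x → 0ℚ ≤ f x) →
  ∀ {xs} → All (λ x → P x ⊎ 1ℚ ≤ f x) xs → All P xs ⊎ 1ℚ ≤ sumList f xs
All⊎1≤sumList 0≤f [] = inj₁ []
All⊎1≤sumList 0≤f {x ∷ xs} (inj₂ 1≤fx ∷ ps) = inj₂ (≤-trans 1≤fx (p≤p+q (0≤sumList 0≤f xs)))
All⊎1≤sumList 0≤f {x ∷ xs} (inj₁ px ∷ ps) with All⊎1≤sumList 0≤f ps
... | inj₁ all = inj₁ (px ∷ all)
... | inj₂ 1≤s = inj₂ (≤-trans 1≤s (p≤q+p (0≤f x)))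

-- A union bound: the two valuations give φ the same value unless they disagree at one
-- of its variables, which costs at least 1.
ind-eval-≤ : ∀ φ {v w} {cost : Gen → ℚ} → (∀ g → 0ℚ ≤ cost g) →
  All (λ g → v g ≡ w g ⊎ 1ℚ ≤ cost g) (vars φ) →
  ind (eval v φ) ≤ ind (eval w φ) + sumList cost (vars φ)
ind-eval-≤ φ {v} {w} {cost} 0≤cost h with All⊎1≤sumList 0≤cost h
... | inj₁ eqs = subst (λ b → ind (eval v φ) ≤ ind b + sumList cost (vars φ)) (eval-cong φ eqs) (p≤p+q (0≤sumList 0≤cost (vars φ)))
... | inj₂ 1≤s = ≤-trans (ind≤1 (eval v φ)) (≤-trans 1≤s (p≤q+p (0≤ind (eval w φ))))

anyBelow : (ℕ → Bool) → ℕ → Bool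
anyBelow p zero    = false
anyBelow p (suc k) = p k ∨ anyBelow p k

anyBelow-cong : ∀ {p q} K → (∀ k → k ℕ.< K → p k ≡ q k) → anyBelow p K ≡ anyBelow q K
anyBelow-cong zero    h = refl
anyBelow-cong (suc K) h = cong₂ _∨_ (h K ℕ.≤-refl) (anyBelow-cong K λ k k<K → h k (ℕ.m<n⇒m<1+n k<K))

anyBelow-false : ∀ {p} K → anyBelow p K ≡ false → ∀ k → k ℕ.< K → p k ≡ false
anyBelow-false {p} (suc K) h k (ℕ.s≤s k≤K) with p K in eq | ℕ.m≤n⇒m<n∨m≡n k≤K
... | false | inj₁ k<K  = anyBelow-false K h k k<K
... | false | inj₂ refl = eq

anyBelow-none : ∀ {p} K → (∀ k → k ℕ.< K → p k ≡ false) → anyBelow p K ≡ false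
anyBelow-none zero    h = refl
anyBelow-none (suc K) h = cong₂ _∨_ (h K ℕ.≤-refl) (anyBelow-none K λ k k<K → h k (ℕ.m<n⇒m<1+n k<K))

-- If p fails from K on, the longer search finds nothing new; otherwise one of the later indicators
-- contributes 1.
anyBelow-+ : ∀ p K d → anyBelow p (d ℕ.+ K) ≡ anyBelow p K ⊎ 1ℚ ≤ sumFrom (ind ∘ p) K d
anyBelow-+ p K zero = inj₁ refl
anyBelow-+ p K (suc d) with p K | anyBelow-+ p (suc K) d
... | true  | _        = inj₂ (p≤p+q (0≤sumFrom (0≤ind ∘ p) (suc K) d))
... | false | inj₂ 1≤s = inj₂ (≤-trans 1≤s (p≤q+p ≤-refl))
... | false | inj₁ e   = inj₁ (trans (cong (anyBelow p) (sym (ℕ.+-suc d K))) e)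

block : (ℕ → ℕ → Stream) → ℕ → List Stream
block T k = applyUpTo (T k) (blockSize k)

isConstant : (Stream → Bool) → List Stream → Bool
isConstant x D = all x D ∨ all (not ∘ x) D

all-cong : ∀ {x y : Stream → Bool} {D} → All (λ ξ → x ξ ≡ y ξ) D → all x D ≡ all y D
all-cong []         = refl
all-cong (eq ∷ eqs) = cong₂ _∧_ eq (all-cong eqs)

isConstant-cong : ∀ {x y D} → All (λ ξ → x ξ ≡ y ξ) D → isConstant x D ≡ isConstant y D
isConstant-cong eqs = cong₂ _∨_ (all-cong eqs) (all-cong (All.map (cong not) eqs))

-- The test S selects the blocks whose relation is in force: `separated j` at level j, `distinct` in
-- the limit.
violates : (List Stream → Bool) → (Stream → Bool) → (ℕ → ℕ → Stream) → ℕ → Bool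
violates S x T k = S (block T k) ∧ isConstant x (block T k)

-- Corrects a valuation so that family T implies that the first K blocks of T which
-- satisfy S are split by the points.
correct : (List Stream → Bool) → ℕ → (Gen → Bool) → Gen → Bool
correct S K v (point ξ)  = v (point ξ)
correct S K v (family T) = v (family T) ∧ not (anyBelow (violates S (v ∘ point) T) K)

module Construction (em : ExcludedMiddle 0ℓ) where

  separated : ℕ → List Stream → Bool
  separated j D = ⌊ em {AllPairs (Sep j) D} ⌋

  correctAt : ℕ → (Gen → Bool) → Gen → Bool
  correctAt j = correct (separated j) j

  infix 4 _≋_

  -- The values of `correctAt j` are exactly the valuations that obey the relations in force at
  -- level j. A consequence of the relations uses only finitely many of them, so this is equality in
  -- the algebra that they present.
  _≋_ : Formula → Formula → Set
  φ ≋ ψ = Eventually λ j → ∀ v → eval (correctAt j v) φ ≡ eval (correctAt j v) ψ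

  tautology : ∀ {φ ψ} → (∀ v → eval v φ ≡ eval v ψ) → φ ≋ ψ
  tautology eq = always λ j v → eq (correctAt j v)

  ≋-sym : ∀ {φ ψ} → φ ≋ ψ → ψ ≋ φ
  ≋-sym = ev-map λ p v → sym (p v)

  ≋-trans : ∀ {φ ψ χ} → φ ≋ ψ → ψ ≋ χ → φ ≋ χ
  ≋-trans = ev-zip λ p q v → trans (p v) (q v)

  𝔅 : BooleanAlgebra 0ℓ 0ℓ
  𝔅 = record
    { Carrier = Formula
    ; _≈_ = _≋_
    ; _∨_ = _⟨∨⟩_
    ; _∧_ = _⟨∧⟩_
    ; ¬_ = ⟨¬⟩_
    ; ⊤ = ⟨⊤⟩
    ; ⊥ = ⟨⊥⟩
    ; isBooleanAlgebra = record
      { isDistributiveLattice = record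
        { isLattice = record
          { isEquivalence = record
            { refl = λ {φ} → tautology {φ} {φ} λ v → refl
            ; sym = λ {φ} {ψ} → ≋-sym {φ} {ψ}
            ; trans = λ {φ} {ψ} {χ} → ≋-trans {φ} {ψ} {χ}
            }
          ; ∨-comm = λ φ ψ → tautology {φ ⟨∨⟩ ψ} {ψ ⟨∨⟩ φ} λ v → 𝔹.∨-comm (eval v φ) (eval v ψ)
          ; ∨-assoc = λ φ ψ χ → tautology {(φ ⟨∨⟩ ψ) ⟨∨⟩ χ} {φ ⟨∨⟩ ψ ⟨∨⟩ χ}
              λ v → 𝔹.∨-assoc (eval v φ) (eval v ψ) (eval v χ)
          ; ∨-cong = ev-zip λ p q v → cong₂ _∨_ (p v) (q v)
          ; ∧-comm = λ φ ψ → tautology {φ ⟨∧⟩ ψ} {ψ ⟨∧⟩ φ} λ v → 𝔹.∧-comm (eval v φ) (eval v ψ)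
          ; ∧-assoc = λ φ ψ χ → tautology {(φ ⟨∧⟩ ψ) ⟨∧⟩ χ} {φ ⟨∧⟩ ψ ⟨∧⟩ χ}
              λ v → 𝔹.∧-assoc (eval v φ) (eval v ψ) (eval v χ)
          ; ∧-cong = ev-zip λ p q v → cong₂ _∧_ (p v) (q v)
          ; absorptive =
              (λ φ ψ → tautology {φ ⟨∨⟩ φ ⟨∧⟩ ψ} {φ} λ v → 𝔹.∨-abs-∧ (eval v φ) (eval v ψ)) ,
              (λ φ ψ → tautology {φ ⟨∧⟩ (φ ⟨∨⟩ ψ)} {φ} λ v → 𝔹.∧-abs-∨ (eval v φ) (eval v ψ))
          }
        ; ∨-distrib-∧ =
            (λ φ ψ χ → tautology {φ ⟨∨⟩ ψ ⟨∧⟩ χ} {(φ ⟨∨⟩ ψ) ⟨∧⟩ (φ ⟨∨⟩ χ)}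
              λ v → 𝔹.∨-distribˡ-∧ (eval v φ) (eval v ψ) (eval v χ)) ,
            (λ φ ψ χ → tautology {ψ ⟨∧⟩ χ ⟨∨⟩ φ} {(ψ ⟨∨⟩ φ) ⟨∧⟩ (χ ⟨∨⟩ φ)}
              λ v → 𝔹.∨-distribʳ-∧ (eval v φ) (eval v ψ) (eval v χ))
        ; ∧-distrib-∨ =
            (λ φ ψ χ → tautology {φ ⟨∧⟩ (ψ ⟨∨⟩ χ)} {φ ⟨∧⟩ ψ ⟨∨⟩ φ ⟨∧⟩ χ}
              λ v → 𝔹.∧-distribˡ-∨ (eval v φ) (eval v ψ) (eval v χ)) ,
            (λ φ ψ χ → tautology {(ψ ⟨∨⟩ χ) ⟨∧⟩ φ} {ψ ⟨∧⟩ φ ⟨∨⟩ χ ⟨∧⟩ φ}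
              λ v → 𝔹.∧-distribʳ-∨ (eval v φ) (eval v ψ) (eval v χ))
        }
      ; ∨-complement =
          (λ φ → tautology {⟨¬⟩ φ ⟨∨⟩ φ} {⟨⊤⟩} λ v → 𝔹.∨-inverseˡ (eval v φ)) ,
          (λ φ → tautology {φ ⟨∨⟩ ⟨¬⟩ φ} {⟨⊤⟩} λ v → 𝔹.∨-inverseʳ (eval v φ))
      ; ∧-complement =
          (λ φ → tautology {⟨¬⟩ φ ⟨∧⟩ φ} {⟨⊥⟩} λ v → 𝔹.∧-inverseˡ (eval v φ)) ,
          (λ φ → tautology {φ ⟨∧⟩ ⟨¬⟩ φ} {⟨⊥⟩} λ v → 𝔹.∧-inverseʳ (eval v φ))
      ; ¬-cong = ev-map λ p v → cong not (p v)
      }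
    }

-- Random valuations

ind-∧ : ∀ a b → ind (a ∧ b) ≡ ind a * ind b
ind-∧ true  b = sym (*-identityˡ (ind b))
ind-∧ false b = sym (*-zeroˡ (ind b))

ind-∨ : ∀ a b → ind (a ∨ b) ≤ ind a + ind b
ind-∨ true  b = p≤p+q (0≤ind b)
ind-∨ false b = p≤q+p ≤-refl

-- Either some digit differs, and every depth beyond it separates the streams, or extensionality
-- identifies them.
≡⊎Sep : ExcludedMiddle 0ℓ → Extensionality 0ℓ 0ℓ → ∀ ξ η → Eventually λ j → ξ ≡ η ⊎ Sep j ξ η
≡⊎Sep em ext ξ η with em {∃[ i ] (ξ i ≢ η i)}
... | yes (i , ne) = ev-map (λ i<j → inj₂ (i , i<j , ne)) (from (suc i))
... | no ¬ne = always λ _ → inj₁ (ext λ i → decidable-stable (ξ i 𝔹.≟ η i) λ ne → ¬ne (i , ne))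

randomise : (Gen → Bool) → (Stream → Bool) → Gen → Bool
randomise F x (point ξ)  = F (point ξ) xor x ξ
randomise F x (family T) = F (family T)

-- The finitely many streams whose points can influence g once the first K blocks have been
-- corrected.
relevant : ℕ → Gen → List Stream
relevant K (point ξ)        = [ ξ ]
relevant zero (family T)    = []
relevant (suc K) (family T) = block T K ++ relevant K (family T)

relevant-block : ∀ {P : Stream → Set} {T K} → All P (relevant K (family T)) → ∀ k → k ℕ.< K → All P (block T k)
relevant-block {T = T} {suc K} h k (ℕ.s≤s k≤K) with ℕ.m≤n⇒m<n∨m≡n k≤K
... | inj₁ k<K  = relevant-block (All.++⁻ʳ (block T K) h) k k<K
... | inj₂ refl = All.++⁻ˡ (block T K) h

correct-cong : ∀ S K {v w} g → v g ≡ w g → All (λ ξ → v (point ξ) ≡ w (point ξ)) (relevant K g) →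
  correct S K v g ≡ correct S K w g
correct-cong S K (point ξ)  eq _ = eq
correct-cong S K (family T) eq h = cong₂ _∧_ eq (cong not (anyBelow-cong K λ k k<K →
  cong (S (block T k) ∧_) (isConstant-cong (relevant-block h k k<K))))

-- The number of violated blocks with index from K to K + d - 1: the price of looking only at the
-- first K blocks.
tailCost : (List Stream → Bool) → (Stream → Bool) → ℕ → ℕ → Gen → ℚ
tailCost S x K d (point ξ)  = 0ℚ
tailCost S x K d (family T) = sumFrom (ind ∘ violates S x T) K d

0≤tailCost : ∀ S x K d g → 0ℚ ≤ tailCost S x K d g
0≤tailCost S x K d (point ξ)  = ≤-refl
0≤tailCost S x K d (family T) = 0≤sumFrom (λ k → 0≤ind (violates S x T k)) K d

-- The tests S and S′ need to agree on the first K blocks only, because any violation in a later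
-- block is paid for by the cost.
correct-≡⊎1≤tailCost : ∀ S S′ K d v g →
  (∀ T → g ≡ family T → ∀ k → k ℕ.< K → S (block T k) ≡ S′ (block T k)) →
  correct S (d ℕ.+ K) v g ≡ correct S′ K v g ⊎ 1ℚ ≤ tailCost S (v ∘ point) K d g
correct-≡⊎1≤tailCost S S′ K d v (point ξ) h = inj₁ refl
correct-≡⊎1≤tailCost S S′ K d v (family T) h with anyBelow-+ (violates S (v ∘ point) T) K d
... | inj₂ 1≤s = inj₂ 1≤s
... | inj₁ eq  = inj₁ (cong (λ b → v (family T) ∧ not b) (trans eq
  (anyBelow-cong K λ k k<K → cong (_∧ isConstant (v ∘ point) (block T k)) (h T refl k k<K))))

module Random (em : ExcludedMiddle 0ℓ)
              (δ : ℚ) (0≤δ : 0ℚ ≤ δ) (2δ≤1 : δ + δ ≤ 1ℚ) where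

  open Construction em

  δ≤1 : δ ≤ 1ℚ
  δ≤1 = ≤-trans (p≤p+q 0≤δ) 2δ≤1

  open Expectation δ 0≤δ δ≤1 public

  -- Hence a noisy bit takes either prescribed value with probability at most 1 - δ, whatever F says
  -- about it.
  δ≤1-δ : δ ≤ 1ℚ - δ
  δ≤1-δ = subst (_≤ 1ℚ - δ) (solve 1 (λ d → d :+ d :- d := d) refl δ) (+-monoˡ-≤ (Data.Rational.- δ) 2δ≤1)
    where open +-*-Solver

  -- Resample the leaf of the first stream. Separation keeps the bits of the other streams
  -- unchanged, so the expectation factors, and each stream contributes at most 1 - δ.
  E-all : ∀ j (p : Stream → Bool → Bool) → (∀ ξ → E₀ (ind ∘ p ξ) ≤ 1ℚ - δ) → ∀ {D} → AllPairs (Sep j) D →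
    E j (λ t → ind (all (λ ξ → p ξ (get t ξ)) D)) ≤ (1ℚ - δ) ^ length D
  E-all j p h [] = ≤-reflexive (E-const j 1ℚ)
  E-all j p h {ξ ∷ D} (seps ∷ rest) = begin
    E j (λ t → ind (p ξ (get t ξ) ∧ all (λ ξ → p ξ (get t ξ)) D))
      ≡⟨ E-resample j _ ξ ⟩
    E₀ (λ c → E j λ t → ind (p ξ (get (set t ξ c) ξ) ∧ all (λ η → p η (get (set t ξ c) η)) D))
      ≡⟨ E₀-cong (λ c → E-cong j λ t → cong₂ (λ a b → ind (p ξ a ∧ b)) (get-set-≡ t ξ c)
           (all-cong (All.map (λ {η} s → cong (p η) (get-set-≢ t c s)) seps))) ⟩
    E₀ (λ c → E j λ t → ind (p ξ c ∧ all (λ ξ → p ξ (get t ξ)) D))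
      ≡⟨ E₀-cong (λ c → E-cong j λ t → ind-∧ (p ξ c) (match t)) ⟩
    E₀ (λ c → E j λ t → ind (p ξ c) * ind (match t))
      ≡⟨ E₀-cong (λ c → E-* j (ind (p ξ c)) (ind ∘ match)) ⟩
    E₀ (λ c → ind (p ξ c) * e)
      ≡⟨ E₀-cong (λ c → *-comm (ind (p ξ c)) e) ⟩
    E₀ (λ c → e * ind (p ξ c))
      ≡⟨ E-* zero e (ind ∘ p ξ) ⟩
    e * E₀ (ind ∘ p ξ)
      ≤⟨ *-mono-left 0≤e (h ξ) ⟩
    e * (1ℚ - δ)
      ≤⟨ *-mono-right (0≤1- δ≤1) (E-all j p h rest) ⟩
    (1ℚ - δ) ^ length D * (1ℚ - δ)
      ≡⟨ *-comm _ (1ℚ - δ) ⟩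
    (1ℚ - δ) ^ suc (length D) ∎
    where
    open ≤-Reasoning
    match : Tree j → Bool
    match t = all (λ ξ → p ξ (get t ξ)) D
    e = E j (ind ∘ match)
    0≤e = ≤-trans (≤-reflexive (sym (E-const j 0ℚ))) (E-mono j λ t → 0≤ind (match t))

  E₀-xor : ∀ b → E₀ (λ c → ind (b xor c)) ≤ 1ℚ - δ
  E₀-xor true  = ≤-reflexive (solve 1 (λ d → (con 1ℚ :- d) :* con 1ℚ :+ d :* con 0ℚ := con 1ℚ :- d) refl δ)
    where open +-*-Solver
  E₀-xor false = ≤-trans (≤-reflexive (solve 1 (λ d → (con 1ℚ :- d) :* con 0ℚ :+ d :* con 1ℚ := d) refl δ)) δ≤1-δ
    where open +-*-Solver

  E₀-not-xor : ∀ b → E₀ (λ c → ind (not (b xor c))) ≤ 1ℚ - δ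
  E₀-not-xor true  = E₀-xor false
  E₀-not-xor false = E₀-xor true

  -- A block that is not separated is never violated. A separated one is violated when its points
  -- are all true or all false, and `E-all` bounds each case.
  E-violates : ∀ j F T k →
    E j (λ t → ind (violates (separated j) (randomise F (get t) ∘ point) T k)) ≤ (1ℚ - δ) ^ blockSize k + (1ℚ - δ) ^ blockSize k
  E-violates j F T k with em {AllPairs (Sep j) (block T k)}
  ... | no _ = ≤-trans (≤-reflexive (E-const j 0ℚ)) (0≤+ 0≤q 0≤q)
    where 0≤q = 0≤^ (blockSize k) (0≤1- δ≤1)
  ... | yes sep = begin
    E j (λ t → ind (all (x t) D ∨ all (not ∘ x t) D))
      ≤⟨ E-mono j (λ t → ind-∨ (all (x t) D) (all (not ∘ x t) D)) ⟩
    E j (λ t → ind (all (x t) D) + ind (all (not ∘ x t) D))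
      ≡⟨ E-+ j _ _ ⟩
    E j (λ t → ind (all (x t) D)) + E j (λ t → ind (all (not ∘ x t) D))
      ≤⟨ +-mono-≤ (E-all j (λ ξ c → F (point ξ) xor c) (λ ξ → E₀-xor (F (point ξ))) sep)
                  (E-all j (λ ξ c → not (F (point ξ) xor c)) (λ ξ → E₀-not-xor (F (point ξ))) sep) ⟩
    (1ℚ - δ) ^ length D + (1ℚ - δ) ^ length D
      ≡⟨ cong (λ n → (1ℚ - δ) ^ n + (1ℚ - δ) ^ n) (length-applyUpTo (T k) (blockSize k)) ⟩
    (1ℚ - δ) ^ blockSize k + (1ℚ - δ) ^ blockSize k ∎
    where
    open ≤-Reasoning
    D = block T k
    x = λ t → randomise F (get t) ∘ point

  -- The bound depends neither on the level j nor on d, which is what makes truncation to K blocks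
  -- harmless in the limit.
  E-tailCost : ∀ {c} K → 0ℚ ≤ c → 1ℚ ≤ c * (ι (offset K) * δ) → ∀ j F d g →
    E j (λ t → tailCost (separated j) (randomise F (get t) ∘ point) K d g) ≤ c * ½ ^ (1 ℕ.+ K)
  E-tailCost K 0≤c h j F d (point ξ) = ≤-trans (≤-reflexive (E-const j 0ℚ)) (0≤* 0≤c (0≤^ (1 ℕ.+ K) 0≤½))
  E-tailCost {c} K 0≤c h j F d (family T) = E-sumFrom j _ c K bound 0≤c d
    where
    open ≤-Reasoning
    open +-*-Solver
    bound : ∀ k → K ℕ.≤ k → E j (λ t → ind (violates (separated j) (randomise F (get t) ∘ point) T k)) ≤ c * ½ ^ (2 ℕ.+ k)
    bound k K≤k = begin
      E j (λ t → ind (violates (separated j) (randomise F (get t) ∘ point) T k))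
        ≤⟨ E-violates j F T k ⟩
      (1ℚ - δ) ^ blockSize k + (1ℚ - δ) ^ blockSize k
        ≤⟨ +-mono-≤ q≤ q≤ ⟩
      c * ½ ^ (3 ℕ.+ k) + c * ½ ^ (3 ℕ.+ k)
        ≡⟨ solve 2 (λ c h → c :* (con ½ :* h) :+ c :* (con ½ :* h) := c :* h) refl c (½ ^ (2 ℕ.+ k)) ⟩
      c * ½ ^ (2 ℕ.+ k) ∎
      where q≤ = [1-δ]^blockSize K k 0≤δ δ≤1 0≤c h K≤k

  DependsOnlyOn : List Stream → ((Stream → Bool) → ℚ) → Set
  DependsOnlyOn D Φ = ∀ x y → All (λ ξ → x ξ ≡ y ξ) D → Φ x ≡ Φ y

  -- The counterpart of `set` on assignments to all streams. It mentions no depth, so the value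
  -- computed in `stationary` is the same for all j.
  override : Stream → Bool → (Stream → Bool) → Stream → Bool
  override ξ c x η = if ⌊ em {ξ ≡ η} ⌋ then c else x η

  override-get : ∀ {j} ξ c (t : Tree j) {D} → All (λ η → ξ ≡ η ⊎ Sep j ξ η) D →
    All (λ η → get (set t ξ c) η ≡ override ξ c (get t) η) (ξ ∷ D)
  override-get {j} ξ c t seps = go (inj₁ refl) ∷ All.map go seps
    where
    go : ∀ {η} → ξ ≡ η ⊎ Sep j ξ η → get (set t ξ c) η ≡ override ξ c (get t) η
    go {η} s with em {ξ ≡ η} | s
    ... | yes refl | _          = get-set-≡ t ξ c
    ... | no ne    | inj₁ eq    = contradiction eq ne
    ... | no ne    | inj₂ sep   = get-set-≢ t c sep

  override-cong : ∀ ξ c {x y D} → All (λ η → x η ≡ y η) D → All (λ η → override ξ c x η ≡ override ξ c y η) (ξ ∷ D)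
  override-cong ξ c {x} {y} eqs = head ∷ All.map go eqs
    where
    head : override ξ c x ξ ≡ override ξ c y ξ
    head with em {ξ ≡ ξ}
    ... | yes _ = refl
    ... | no ne = contradiction refl ne
    go : ∀ {η} → x η ≡ y η → override ξ c x η ≡ override ξ c y η
    go {η} eq with em {ξ ≡ η}
    ... | yes _ = refl
    ... | no  _ = eq

  -- The bits read off a tree at finitely many streams are independent and identically
  -- distributed as soon as the depth separates the streams.
  stationary : ∀ D Φ → DependsOnlyOn D Φ →
    ∃[ e ] (∀ j → AllPairs (λ ξ η → ξ ≡ η ⊎ Sep j ξ η) D → E j (Φ ∘ get) ≡ e)
  stationary [] Φ dep = Φ (λ _ → false) , λ j _ → trans (E-cong j λ t → dep _ _ []) (E-const j _)
  stationary (ξ ∷ D) Φ dep = E₀ (λ c → proj₁ (ih c)) , λ { j (seps ∷ rest) →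
      trans (E-resample j (Φ ∘ get) ξ)
      (E₀-cong λ c → trans (E-cong j λ t → dep _ _ (override-get ξ c t seps)) (proj₂ (ih c) j rest)) }
    where ih = λ c → stationary D (Φ ∘ override ξ c) (λ x y eqs → dep _ _ (override-cong ξ c eqs))

-- The measures

0<ι : ∀ n → 0ℚ < ι (suc n)
0<ι n = <-≤-trans (*<* (+<+ (ℕ.s≤s ℕ.z≤n))) (ι-mono {1} {suc n} (ℕ.s≤s ℕ.z≤n))

ι-positive : ∀ n → Positive (ι (suc n))
ι-positive n = positive (0<ι n)

ι-nonZero : ∀ n → NonZero (ι (suc n))
ι-nonZero n = pos⇒nonZero (ι (suc n)) ⦃ ι-positive n ⦄

abstract
  -- The shift by 2 keeps the noise at most a half; `rate 0` gives fair bits.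
  rate : ℕ → ℚ
  rate n = 1/_ (ι (2 ℕ.+ n)) ⦃ ι-nonZero (1 ℕ.+ n) ⦄

  ι*rate : ∀ n → ι (2 ℕ.+ n) * rate n ≡ 1ℚ
  ι*rate n = *-inverseʳ (ι (2 ℕ.+ n)) ⦃ ι-nonZero (1 ℕ.+ n) ⦄

  0≤rate : ∀ n → 0ℚ ≤ rate n
  0≤rate n = <⇒≤ (positive⁻¹ (rate n) ⦃ 1/pos⇒pos (ι (2 ℕ.+ n)) ⦃ ι-positive (1 ℕ.+ n) ⦄ ⦄)

rate+rate≤1 : ∀ n → rate n + rate n ≤ 1ℚ
rate+rate≤1 n = begin
  rate n + rate n                  ≤⟨ p≤p+q (0≤* (0≤ι n) (0≤rate n)) ⟩
  rate n + rate n + ι n * rate n   ≡⟨ solve 2 (λ r i → r :+ r :+ i :* r := (con 1ℚ :+ (con 1ℚ :+ i)) :* r) refl (rate n) (ι n) ⟩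
  ι (2 ℕ.+ n) * rate n             ≡⟨ ι*rate n ⟩
  1ℚ                               ∎
  where open ≤-Reasoning
        open +-*-Solver

1≤offset : ∀ K → 1 ℕ.≤ offset K
1≤offset K = ℕ.<⇒≤ (offset-mono {0} {K} ℕ.z≤n)

-- For fixed noise the constant `ι (2 + n)` serves every K, so the tail bound tends to 0 as K grows.
1≤ι*offset*rate : ∀ n K → 1ℚ ≤ ι (2 ℕ.+ n) * (ι (offset K) * rate n)
1≤ι*offset*rate n K = begin
  1ℚ                                       ≡⟨ ι*rate n ⟨
  ι (2 ℕ.+ n) * rate n                     ≡⟨ cong (ι (2 ℕ.+ n) *_) (*-identityˡ (rate n)) ⟨
  ι (2 ℕ.+ n) * (ι 1 * rate n)             ≤⟨ *-mono-left (0≤ι (2 ℕ.+ n)) (*-mono-right (0≤rate n) (ι-mono {1} {offset K} (1≤offset K))) ⟩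
  ι (2 ℕ.+ n) * (ι (offset K) * rate n)    ∎
  where open ≤-Reasoning

length-relevant : ∀ K g → length (relevant K g) ℕ.≤ offset K
length-relevant K (point ξ)        = 1≤offset K
length-relevant zero (family T)    = ℕ.z≤n
length-relevant (suc K) (family T) = begin
  length (block T K ++ relevant K (family T))             ≡⟨ length-++ (block T K) ⟩
  length (block T K) ℕ.+ length (relevant K (family T))   ≤⟨ ℕ.+-mono-≤ (ℕ.≤-reflexive (length-applyUpTo (T K) (blockSize K))) (length-relevant K (family T)) ⟩
  blockSize K ℕ.+ offset K                                ≡⟨ ℕ.+-comm (blockSize K) (offset K) ⟩
  offset (suc K)                                          ∎
  where open ℕ.≤-Reasoning

∣p-q∣≤ : ∀ {p q b} → p ≤ q + b → q ≤ p + b → ∣ p - q ∣ ≤ b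
∣p-q∣≤ {p} {q} {b} p≤q+b q≤p+b with ∣p∣≡p∨∣p∣≡-p (p - q)
... | inj₁ eq = begin
  ∣ p - q ∣   ≡⟨ eq ⟩
  p - q       ≤⟨ +-monoˡ-≤ (- q) p≤q+b ⟩
  q + b - q   ≡⟨ solve 2 (λ q b → q :+ b :- q := b) refl q b ⟩
  b           ∎
  where open ≤-Reasoning
        open +-*-Solver
... | inj₂ eq = begin
  ∣ p - q ∣   ≡⟨ eq ⟩
  - (p - q)   ≡⟨ solve 2 (λ p q → :- (p :- q) := q :- p) refl p q ⟩
  q - p       ≤⟨ +-monoˡ-≤ (- p) q≤p+b ⟩
  p + b - p   ≡⟨ solve 2 (λ p b → p :+ b :- p := b) refl p b ⟩
  b           ∎
  where open ≤-Reasoning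
        open +-*-Solver

∣p-q∣≤b+b : ∀ p q e b → p ≤ e + b × e ≤ p + b → q ≤ e + b × e ≤ q + b → ∣ p - q ∣ ≤ b + b
∣p-q∣≤b+b p q e b (p≤ , e≤p) (q≤ , e≤q) = ∣p-q∣≤ {p} {q} (through p q p≤ e≤q) (through q p q≤ e≤p)
  where
  through : ∀ p q → p ≤ e + b → e ≤ q + b → p ≤ q + (b + b)
  through p q p≤ e≤ = ≤-trans p≤ (≤-trans (+-monoˡ-≤ b e≤) (≤-reflexive (+-assoc q b b)))

eventually-≡⇒≃ : ∀ {x y} → Eventually (λ j → seq x j ≡ seq y j) → x ≃ y
eventually-≡⇒≃ {x} {y} (N , eq) ε 0<ε = N , λ n N≤n →
  subst (_< ε) (sym (trans (cong (λ q → ∣ q - seq y n ∣) (eq n N≤n)) (cong ∣_∣ (+-inverseʳ (seq y n))))) 0<ε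

ind-∨-disjoint : ∀ a b → a ∧ b ≡ false → ind (a ∨ b) ≡ ind a + ind b
ind-∨-disjoint true  false _ = refl
ind-∨-disjoint false b     _ = sym (+-identityˡ (ind b))

module Measures (em : ExcludedMiddle 0ℓ) (ext : Extensionality 0ℓ 0ℓ) where

  open Construction em public

  -- The limit of `separated j` as the level j grows.
  distinct : List Stream → Bool
  distinct D = ⌊ em {∃[ j ] AllPairs (Sep j) D} ⌋

  separated≡distinct : ∀ D → Eventually λ j → separated j D ≡ distinct D
  separated≡distinct D with em {∃[ j ] AllPairs (Sep j) D}
  ... | yes (i , sep) = ev-map yes-case (from i)
    where
    yes-case : ∀ {j} → i ℕ.≤ j → separated j D ≡ true
    yes-case {j} i≤j with em {AllPairs (Sep j) D}
    ... | yes _ = refl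
    ... | no ¬s = contradiction (AllPairs.map (Sep-mono i≤j) sep) ¬s
  ... | no ¬sep = always no-case
    where
    no-case : ∀ j → separated j D ≡ false
    no-case j with em {AllPairs (Sep j) D}
    ... | yes s = contradiction (j , s) ¬sep
    ... | no _  = refl

  -- Level j has already settled which of the first K blocks of g count.
  Resolved : ℕ → ℕ → Gen → Set
  Resolved K j g = ∀ T → g ≡ family T → ∀ k → k ℕ.< K → separated j (block T k) ≡ distinct (block T k)

  resolved : ∀ K g → Eventually λ j → Resolved K j g
  resolved K (point ξ)  = always λ _ _ ()
  resolved K (family T) = ev-map (λ { h _ refl → h }) (ev-below (λ k → separated≡distinct (block T k)) K)

  correctAt-≡⊎1≤tailCost : ∀ {K j g} → K ℕ.≤ j → Resolved K j g → ∀ v →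
    correctAt j v g ≡ correct distinct K v g ⊎ 1ℚ ≤ tailCost (separated j) (v ∘ point) K (j ℕ.∸ K) g
  correctAt-≡⊎1≤tailCost {K} {j} {g} K≤j h v =
    subst (λ i → correct (separated j) i v g ≡ correct distinct K v g ⊎ 1ℚ ≤ tailCost (separated j) (v ∘ point) K (j ℕ.∸ K) g)
      (ℕ.m∸n+n≡m K≤j) (correct-≡⊎1≤tailCost (separated j) distinct K (j ℕ.∸ K) v g h)

  module Noise (n : ℕ) where

    open Random em (rate n) (0≤rate n) (rate+rate≤1 n) public

    prob : (Gen → Bool) → Formula → ℕ → ℚ
    prob F φ j = E j λ t → ind (eval (correctAt j (randomise F (get t))) φ)

    prob-cong : ∀ F {φ ψ} → φ ≋ ψ → Eventually λ j → prob F φ j ≡ prob F ψ j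
    prob-cong F = ev-map λ {j} eq → E-cong j λ t → cong ind (eq (randomise F (get t)))

    -- Correct only the first K blocks, with the limiting test `distinct`. The outcome depends on
    -- finitely many streams, so by `stationary` its expectation e is eventually constant in j; the
    -- discrepancy is charged to the later blocks.
    approximation : ∀ F φ K → ∃[ e ] Eventually λ j →
      let b = ι (length (vars φ)) * (ι (2 ℕ.+ n) * ½ ^ (1 ℕ.+ K)) in
      prob F φ j ≤ e + b × e ≤ prob F φ j + b
    approximation F φ K = e , ev-zip (λ {j} → bounds {j}) (ev-AllPairs (≡⊎Sep em ext) D) (ev-zip _,_ (from K) (ev-All (resolved K) (vars φ)))
      where
      D = concatMap (relevant K) (vars φ)
      b = ι (length (vars φ)) * (ι (2 ℕ.+ n) * ½ ^ (1 ℕ.+ K))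
      agree : ∀ x y g → All (λ ξ → x ξ ≡ y ξ) (relevant K g) →
        correct distinct K (randomise F x) g ≡ correct distinct K (randomise F y) g
      agree x y (point ξ)  (eq ∷ []) = cong (F (point ξ) xor_) eq
      agree x y (family T) eqs = correct-cong distinct K {randomise F x} {randomise F y} (family T) refl (All.map (λ {ξ} → cong (F (point ξ) xor_)) eqs)
      Φ : (Stream → Bool) → ℚ
      Φ x = ind (eval (correct distinct K (randomise F x)) φ)
      Φ-local : DependsOnlyOn D Φ
      Φ-local x y eqs = cong ind (eval-cong φ (All.map (λ {g} → agree x y g) (All.map⁻ (All.concat⁻ eqs))))
      e = proj₁ (stationary D Φ Φ-local)
      law = proj₂ (stationary D Φ Φ-local)
      bounds : ∀ {j} → AllPairs (λ ξ η → ξ ≡ η ⊎ Sep j ξ η) D → K ℕ.≤ j × All (Resolved K j) (vars φ) →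
        prob F φ j ≤ e + b × e ≤ prob F φ j + b
      bounds {j} seps (K≤j , res) = (begin
          prob F φ j                    ≤⟨ E-mono j (λ t → ind-eval-≤ φ (0≤cost t) (All.map (λ r → correctAt-≡⊎1≤tailCost K≤j r _) res)) ⟩
          E j (λ t → limit t + total t) ≡⟨ E-+ j limit total ⟩
          E j limit + E j total         ≤⟨ +-mono-≤ (≤-reflexive (law j seps)) total≤ ⟩
          e + b                         ∎) , (begin
          e                             ≡⟨ law j seps ⟨
          E j limit                     ≤⟨ E-mono j (λ t → ind-eval-≤ φ (0≤cost t) (All.map (λ r → flip (correctAt-≡⊎1≤tailCost K≤j r _)) res)) ⟩
          E j (λ t → ind (eval (correctAt j (randomise F (get t))) φ) + total t) ≡⟨ E-+ j _ total ⟩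
          prob F φ j + E j total        ≤⟨ +-monoʳ-≤ (prob F φ j) total≤ ⟩
          prob F φ j + b                ∎)
        where
        open ≤-Reasoning
        limit total : Tree j → ℚ
        limit = Φ ∘ get
        cost : Tree j → Gen → ℚ
        cost t = tailCost (separated j) (randomise F (get t) ∘ point) K (j ℕ.∸ K)
        total t = sumList (cost t) (vars φ)
        0≤cost : ∀ t g → 0ℚ ≤ cost t g
        0≤cost t = 0≤tailCost (separated j) (randomise F (get t) ∘ point) K (j ℕ.∸ K)
        flip : ∀ {p q : Bool} {r} → p ≡ q ⊎ 1ℚ ≤ r → q ≡ p ⊎ 1ℚ ≤ r
        flip (inj₁ eq) = inj₁ (sym eq)
        flip (inj₂ le) = inj₂ le
        total≤ : E j total ≤ b
        total≤ = E-sumList j (λ g t → cost t g) _ (E-tailCost K (0≤ι (2 ℕ.+ n)) (1≤ι*offset*rate n K) j F (j ℕ.∸ K)) (vars φ)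

    prob-cauchy : ∀ F φ → IsCauchy (prob F φ)
    prob-cauchy F φ ε 0<ε = N , λ i j N≤i N≤j →
        ≤-<-trans (∣p-q∣≤b+b (prob F φ i) (prob F φ j) e b (bound i N≤i) (bound j N≤j)) b+b<ε
      where
      ℓ = length (vars φ)
      -- Two terms lie within b of e, and b + b equals `ℓ * (2 + n)` times `½ ^ k`.
      small = ι*½^-small (ℓ ℕ.* (2 ℕ.+ n)) 0<ε
      k = proj₁ small
      approx = approximation F φ k
      e = proj₁ approx
      N = proj₁ (proj₂ approx)
      bound = proj₂ (proj₂ approx)
      b = ι ℓ * (ι (2 ℕ.+ n) * ½ ^ (1 ℕ.+ k))
      b+b<ε : b + b < ε
      b+b<ε = begin-strict
        b + b                               ≡⟨ solve 3 (λ l c h → l :* (c :* (con ½ :* h)) :+ l :* (c :* (con ½ :* h)) := l :* c :* h) refl (ι ℓ) (ι (2 ℕ.+ n)) (½ ^ k) ⟩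
        ι ℓ * ι (2 ℕ.+ n) * ½ ^ k           ≡⟨ cong (_* ½ ^ k) (×1-homo-* ℓ (2 ℕ.+ n)) ⟨
        ι (ℓ ℕ.* (2 ℕ.+ n)) * ½ ^ k         <⟨ proj₂ small ⟩
        ε                                   ∎
        where open ≤-Reasoning
              open +-*-Solver

    0≤prob : ∀ F φ j → 0ℚ ≤ prob F φ j
    0≤prob F φ j = ≤-trans (≤-reflexive (sym (E-const j 0ℚ)))
      (E-mono j {λ _ → 0ℚ} {λ t → ind (eval (correctAt j (randomise F (get t))) φ)} λ t →
        0≤ind (eval (correctAt j (randomise F (get t))) φ))

    probᴿ : (Gen → Bool) → Formula → ℝ
    probᴿ F φ = mkℝ (prob F φ) (prob-cauchy F φ)

    0≤probᴿ : ∀ F φ → 0ᴿ ≤ᴿ probᴿ F φ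
    0≤probᴿ F φ (ε , 0<ε , N , h) = <-irrefl {ε} refl (<-≤-trans {ε} {0ℚ - prob F φ N} (h N ℕ.≤-refl)
      (≤-trans (≤-reflexive (+-identityˡ (- prob F φ N))) (≤-trans (neg-antimono-≤ (0≤prob F φ N)) (<⇒≤ 0<ε))))

    prob-add : ∀ F φ ψ → φ ⟨∧⟩ ψ ≋ ⟨⊥⟩ → Eventually λ j → prob F (φ ⟨∨⟩ ψ) j ≡ prob F φ j + prob F ψ j
    prob-add F φ ψ = ev-map λ {j} eq →
      trans (E-cong j λ t → ind-∨-disjoint (value t φ) (value t ψ) (eq (randomise F (get t))))
        (E-+ j (λ t → ind (value t φ)) (λ t → ind (value t ψ)))
      where
      value : ∀ {j} → Tree j → Formula → Bool
      value {j} t = eval (correctAt j (randomise F (get t)))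

    measure : (Gen → Bool) → Measure 𝔅
    measure F = record
      { μ = probᴿ F
      ; μ-cong = λ {φ} {ψ} eq → eventually-≡⇒≃ {probᴿ F φ} {probᴿ F ψ} (prob-cong F {φ} {ψ} eq)
      ; μ-nonneg = 0≤probᴿ F
      ; μ-add = λ φ ψ disjoint → eventually-≡⇒≃ {probᴿ F (φ ⟨∨⟩ ψ)} {probᴿ F φ +ᴿ probᴿ F ψ} (prob-add F φ ψ disjoint)
      }

    probability : ∀ F → IsProbability 𝔅 (measure F)
    probability F = eventually-≡⇒≃ {probᴿ F ⟨⊤⟩} {1ᴿ} (always λ j → E-const j 1ℚ)

-- Countably many tables

-- Cantor's walk along the antidiagonals; at the end of one it jumps to the start of the next.
next : ℕ × ℕ → ℕ × ℕ
next (zero  , b) = suc b , 0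
next (suc a , b) = a , suc b

unpair : ℕ → ℕ × ℕ
unpair zero    = 0 , 0
unpair (suc n) = next (unpair n)

unpair-surjective : ∀ a b → ∃[ n ] (unpair n ≡ (a , b))
unpair-surjective a b = diagonal (a ℕ.+ b) a b refl
  where
  along : ∀ s → ∃[ n ] (unpair n ≡ (s , 0)) → ∀ a b → a ℕ.+ b ≡ s → ∃[ n ] (unpair n ≡ (a , b))
  along s start a zero eq = subst (λ a → ∃[ n ] (unpair n ≡ (a , 0))) (trans (sym eq) (ℕ.+-identityʳ a)) start
  along s start a (suc b) eq with along s start (suc a) b (trans (sym (ℕ.+-suc a b)) eq)
  ... | n , eq′ = suc n , cong next eq′
  diagonal : ∀ s a b → a ℕ.+ b ≡ s → ∃[ n ] (unpair n ≡ (a , b))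
  diagonal zero    = along zero (0 , refl)
  diagonal (suc s) with diagonal s 0 s refl
  ... | n , eq = along (suc s) (suc n , cong next eq)

unpair₃ : ℕ → ℕ × ℕ × ℕ
unpair₃ n = proj₁ (unpair n) , unpair (proj₂ (unpair n))

unpair₃-surjective : ∀ p → ∃[ n ] (unpair₃ n ≡ p)
unpair₃-surjective (a , b , c) with unpair-surjective b c
... | m , eq with unpair-surjective a m
... | n , eq′ = n , trans (cong (λ p → proj₁ p , unpair (proj₂ p)) eq′) (cong (a ,_) eq)

treeAt : ∀ h → ℕ → Tree h
treeAt zero    zero    = false
treeAt zero    (suc _) = true
treeAt (suc h) n       = treeAt h (proj₁ (unpair n)) , treeAt h (proj₂ (unpair n))

treeAt-surjective : ∀ h (t : Tree h) → ∃[ n ] (treeAt h n ≡ t)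
treeAt-surjective zero    false   = 0 , refl
treeAt-surjective zero    true    = 1 , refl
treeAt-surjective (suc h) (l , r) with treeAt-surjective h l | treeAt-surjective h r
... | a , eqˡ | b , eqʳ with unpair-surjective a b
... | n , eq = n , cong₂ _,_ (trans (cong (treeAt h ∘ proj₁) eq) eqˡ) (trans (cong (treeAt h ∘ proj₂) eq) eqʳ)

infixr 5 _◂_

_◂_ : Bool → Stream → Stream
(b ◂ ξ) zero    = b
(b ◂ ξ) (suc i) = ξ i

merge : (ℕ → Stream) → Stream
merge f i = f (proj₁ (unpair i)) (proj₂ (unpair i))

-- With generators coded injectively by streams, a finite binary tree can serve as a table of values
-- for points and families alike.
code : Gen → Stream
code (point ξ)  = false ◂ ξ
code (family T) = true ◂ merge (merge ∘ T)

module Coding (em : ExcludedMiddle 0ℓ) (ext : Extensionality 0ℓ 0ℓ) where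

  merge-injective : ∀ {f g} → merge f ≡ merge g → f ≡ g
  merge-injective {f} {g} eq = ext λ a → ext λ b → at (unpair-surjective a b)
    where
    at : ∀ {a b} → ∃[ n ] (unpair n ≡ (a , b)) → f a b ≡ g a b
    at (n , n↦ab) = subst (λ p → f (proj₁ p) (proj₂ p) ≡ g (proj₁ p) (proj₂ p)) n↦ab (cong (λ ξ → ξ n) eq)

  code-injective : ∀ g h → code g ≡ code h → g ≡ h
  code-injective (point ξ)  (point η)  eq = cong (point ∘ tail) eq
  code-injective (point ξ)  (family T) eq with () ← cong (λ ξ → ξ 0) eq
  code-injective (family T) (point ξ)  eq with () ← cong (λ ξ → ξ 0) eq
  code-injective (family T) (family U) eq = cong family (ext λ k →
    merge-injective (cong (λ f → f k) (merge-injective (cong tail eq))))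

  -- Write the values into the tree one at a time. A write spoils no earlier value: other codes sit
  -- at other leaves, and equal codes belong to the same generator, which has the same value.
  fit : ∀ (w : Gen → Bool) {h} L → AllPairs (λ g g′ → code g ≡ code g′ ⊎ Sep h (code g) (code g′)) L →
    ∃[ s ] All (λ g → get (treeAt h s) (code g) ≡ w g) L
  fit w [] [] = 0 , []
  fit w {h} (g ∷ L) (seps ∷ rest) with fit w L rest
  ... | s , fits with treeAt-surjective h (set (treeAt h s) (code g) (w g))
  ... | s′ , eq = s′ , subst (λ t → All (λ g → get t (code g) ≡ w g) (g ∷ L)) (sym eq)
    (get-set-≡ (treeAt h s) (code g) (w g) ∷ All.zipWith (λ {g′} → keep {g′}) (seps , fits))
    where
    keep : ∀ {g′} → (code g ≡ code g′ ⊎ Sep h (code g) (code g′)) × get (treeAt h s) (code g′) ≡ w g′ →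
      get (set (treeAt h s) (code g) (w g)) (code g′) ≡ w g′
    keep {g′} (inj₂ sep , eq) = trans (get-set-≢ (treeAt h s) (w g) sep) eq
    keep {g′} (inj₁ same , _) with refl ← code-injective g g′ same = get-set-≡ (treeAt h s) (code g) (w g)

  tableAt : ℕ → ℕ → Gen → Bool
  tableAt h s g = get (treeAt h s) (code g)

  tableAt-fits : ∀ (w : Gen → Bool) L → ∃[ h ] ∃[ s ] All (λ g → tableAt h s g ≡ w g) L
  tableAt-fits w L with ev-AllPairs (λ g g′ → ≡⊎Sep em ext (code g) (code g′)) L
  ... | h , sep = h , fit w L (sep h ℕ.≤-refl)

-- Approximability

false⊎1≤ind : ∀ b → b ≡ false ⊎ 1ℚ ≤ ind b
false⊎1≤ind true  = inj₂ ≤-refl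
false⊎1≤ind false = inj₁ refl

-- If the family survives the first correction, none of its first j blocks is violated, so a second
-- correction of the first K finds nothing to do.
correct-idem : ∀ S S′ {j K} v g → K ℕ.≤ j →
  (∀ T → g ≡ family T → ∀ k → k ℕ.< K → S (block T k) ≡ S′ (block T k)) →
  correct S′ K (correct S j v) g ≡ correct S j v g
correct-idem S S′ v (point ξ) K≤j h = refl
correct-idem S S′ {j} {K} v (family T) K≤j h with v (family T) | anyBelow (violates S (v ∘ point) T) j in eq
... | false | _     = refl
... | true  | true  = refl
... | true  | false = cong not (anyBelow-none K λ k k<K →
  trans (cong (_∧ isConstant (v ∘ point) (block T k)) (sym (h T refl k k<K))) (anyBelow-false j eq k (ℕ.<-≤-trans k<K K≤j)))

randomise-quiet : ∀ (F w : Gen → Bool) x K g → F g ≡ w g → All (λ ξ → x ξ ≡ false) (relevant K g) → randomise F x g ≡ w g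
randomise-quiet F w x K (point ξ) eq (quiet ∷ []) = trans (cong (F (point ξ) xor_) quiet) (trans (𝔹.xor-identityʳ (F (point ξ))) eq)
randomise-quiet F w x K (family T) eq _ = eq

2+a*m≤[a+2]*m : ∀ a m → 1 ℕ.≤ m → 2 ℕ.+ a ℕ.* m ℕ.≤ (a ℕ.+ 2) ℕ.* m
2+a*m≤[a+2]*m a m 1≤m = begin
  2 ℕ.+ a ℕ.* m          ≤⟨ ℕ.+-monoˡ-≤ (a ℕ.* m) (ℕ.*-monoʳ-≤ 2 1≤m) ⟩
  2 ℕ.* m ℕ.+ a ℕ.* m    ≡⟨ ℕ.+-comm (2 ℕ.* m) (a ℕ.* m) ⟩
  a ℕ.* m ℕ.+ 2 ℕ.* m    ≡⟨ ℕ.*-distribʳ-+ m a 2 ⟨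
  (a ℕ.+ 2) ℕ.* m        ∎
  where open ℕ.≤-Reasoning

1≤[a+2]*m*rate : ∀ a m → 1 ℕ.≤ m → 1ℚ ≤ ι (a ℕ.+ 2) * (ι m * rate (a ℕ.* m))
1≤[a+2]*m*rate a m 1≤m = begin
  1ℚ                              ≡⟨ ι*rate (a ℕ.* m) ⟨
  ι (2 ℕ.+ a ℕ.* m) * δ           ≤⟨ *-mono-right (0≤rate (a ℕ.* m)) (ι-mono {2 ℕ.+ a ℕ.* m} {(a ℕ.+ 2) ℕ.* m} (2+a*m≤[a+2]*m a m 1≤m)) ⟩
  ι ((a ℕ.+ 2) ℕ.* m) * δ         ≡⟨ cong (_* δ) (×1-homo-* (a ℕ.+ 2) m) ⟩
  ι (a ℕ.+ 2) * ι m * δ           ≡⟨ *-assoc (ι (a ℕ.+ 2)) (ι m) δ ⟩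
  ι (a ℕ.+ 2) * (ι m * δ)         ∎
  where
  open ≤-Reasoning
  δ = rate (a ℕ.* m)

a*m*rate≤1 : ∀ a m → ι a * (ι m * rate (a ℕ.* m)) ≤ 1ℚ
a*m*rate≤1 a m = begin
  ι a * (ι m * δ)                 ≡⟨ *-assoc (ι a) (ι m) δ ⟨
  ι a * ι m * δ                   ≡⟨ cong (_* δ) (×1-homo-* a m) ⟨
  ι (a ℕ.* m) * δ                 ≤⟨ *-mono-right (0≤rate (a ℕ.* m)) (ι-mono {a ℕ.* m} {2 ℕ.+ a ℕ.* m} (ℕ.m≤n+m (a ℕ.* m) 2)) ⟩
  ι (2 ℕ.+ a ℕ.* m) * δ           ≡⟨ ι*rate (a ℕ.* m) ⟩
  1ℚ                              ∎
  where
  open ≤-Reasoning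
  δ = rate (a ℕ.* m)

a*b*½^≤1 : ∀ a b → ι a * (ι b * ½ ^ (1 ℕ.+ a ℕ.* b)) ≤ 1ℚ
a*b*½^≤1 a b = begin
  ι a * (ι b * ½ ^ (1 ℕ.+ K))     ≡⟨ solve 3 (λ a c h → a :* (c :* (con ½ :* h)) := con ½ :* (a :* c :* h)) refl (ι a) (ι b) (½ ^ K) ⟩
  ½ * (ι a * ι b * ½ ^ K)         ≡⟨ cong (λ z → ½ * (z * ½ ^ K)) (×1-homo-* a b) ⟨
  ½ * (ι K * ½ ^ K)               ≤⟨ *-mono-left 0≤½ (ι*½^≤1 K) ⟩
  ½ * 1ℚ                          ≤⟨ <⇒≤ ½<1 ⟩
  1ℚ                              ∎
  where
  open ≤-Reasoning
  open +-*-Solver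
  K = a ℕ.* b

+-scaled≤2 : ∀ e l {x y} → ι (e ℕ.* l) * x ≤ 1ℚ → ι (e ℕ.* l) * y ≤ 1ℚ → ι e * (ι l * (x + y)) ≤ 1ℚ + 1ℚ
+-scaled≤2 e l {x} {y} x≤ y≤ = begin
  ι e * (ι l * (x + y))                      ≡⟨ solve 4 (λ e l a b → e :* (l :* (a :+ b)) := e :* l :* a :+ e :* l :* b) refl (ι e) (ι l) x y ⟩
  ι e * ι l * x + ι e * ι l * y              ≡⟨ cong (λ z → z * x + z * y) (×1-homo-* e l) ⟨
  ι (e ℕ.* l) * x + ι (e ℕ.* l) * y          ≤⟨ +-mono-≤ x≤ y≤ ⟩
  1ℚ + 1ℚ                                    ∎
  where
  open ≤-Reasoning
  open +-*-Solver

-- With a = e ℓ and c = a + 2, the choice K = a c makes a c ½^(1+K) at most 1. Only then is n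
-- chosen: for M = `offset K`, the noise 1 / (2 + a M) makes M δ at least 1 / c, while a M δ stays
-- at most 1.
parameters : ∀ e ℓ → ∃[ K ] ∃[ n ] ∃[ c ] (0ℚ ≤ c × 1ℚ ≤ c * (ι (offset K) * rate n) ×
  ι e * (ι ℓ * (ι (offset K) * rate n + c * ½ ^ (1 ℕ.+ K))) ≤ 1ℚ + 1ℚ)
parameters e ℓ = K , a ℕ.* offset K , ι (a ℕ.+ 2) , 0≤ι (a ℕ.+ 2) ,
  1≤[a+2]*m*rate a (offset K) (1≤offset K) ,
  +-scaled≤2 e ℓ (a*m*rate≤1 a (offset K)) (a*b*½^≤1 a (a ℕ.+ 2))
  where
  a = e ℕ.* ℓ
  K = a ℕ.* (a ℕ.+ 2)

-- Here s is at most 1/4, so p - 1/2 is at least 1/4. The smaller constant 1/8 is the uniform strict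
-- gap that `<ᴿ` demands.
exceeds-½ : ∀ p s → 1ℚ ≤ p + s → ι 8 * s ≤ 1ℚ + 1ℚ → ½ * (½ * ½) < p - ½
exceeds-½ p s 1≤p+s 8s≤2 = begin-strict
  ½ * (½ * ½)           <⟨ *<* (+<+ (ℕ.s≤s (ℕ.s≤s (ℕ.s≤s (ℕ.s≤s (ℕ.s≤s ℕ.z≤n)))))) ⟩
  1ℚ - ½ * ½ - ½        ≤⟨ +-monoˡ-≤ (- ½) (+-mono-≤ 1≤p+s (neg-antimono-≤ s≤¼)) ⟩
  p + s - s - ½         ≡⟨ solve 2 (λ p s → p :+ s :- s :- con ½ := p :- con ½) refl p s ⟩
  p - ½                 ∎
  where
  open ≤-Reasoning
  open +-*-Solver
  s≤¼ : s ≤ ½ * ½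
  s≤¼ = *-cancelˡ-≤-pos (ι 8) 8s≤2

module Approximability (em : ExcludedMiddle 0ℓ) (ext : Extensionality 0ℓ 0ℓ) where

  open Measures em ext
  open Coding em ext

  -- Since equality is an eventual statement, its failure gives satisfying valuations at arbitrarily
  -- high levels, in particular where the first K blocks are resolved.
  ≉⊥⇒satisfied : ∀ φ → ¬ (φ ≋ ⟨⊥⟩) → ∀ J → ∃[ j ] (J ℕ.≤ j × ∃[ v ] (eval (correctAt j v) φ ≡ true))
  ≉⊥⇒satisfied φ φ≉⊥ J with em {∃[ j ] (J ℕ.≤ j × ∃[ v ] (eval (correctAt j v) φ ≡ true))}
  ... | yes p = p
  ... | no ¬p = contradiction (J , λ j J≤j v → 𝔹.¬-not λ eq → ¬p (j , J≤j , v , eq)) φ≉⊥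

  -- Concentration of the noisy valuation near a satisfying one

  module Concentration (n : ℕ) where

    open Noise n

    δ = rate n

    E-bit : ∀ j ξ → E j (λ t → ind (get t ξ)) ≤ δ
    E-bit j ξ = ≤-reflexive (begin
      E j (λ t → ind (get t ξ))                         ≡⟨ E-resample j (λ t → ind (get t ξ)) ξ ⟩
      E₀ (λ c → E j λ t → ind (get (set t ξ c) ξ))      ≡⟨ E₀-cong (λ c → E-cong j λ t → cong ind (get-set-≡ t ξ c)) ⟩
      E₀ (λ c → E j λ t → ind c)                        ≡⟨ E₀-cong (λ c → E-const j (ind c)) ⟩
      (1ℚ - δ) * 0ℚ + δ * 1ℚ                            ≡⟨ solve 1 (λ d → (con 1ℚ :- d) :* con 0ℚ :+ d :* con 1ℚ := d) refl δ ⟩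
      δ                                                 ∎)
      where open ≡-Reasoning
            open +-*-Solver

    flips tails : ∀ K j → (Gen → Bool) → Gen → Tree j → ℚ
    flips K j F g t = sumList (ind ∘ get t) (relevant K g)
    tails K j F g t = tailCost (separated j) (randomise F (get t) ∘ point) K (j ℕ.∸ K) g

    cost : ∀ K j → (Gen → Bool) → Gen → Tree j → ℚ
    cost K j F g t = flips K j F g t + tails K j F g t

    0≤flips : ∀ K j F g t → 0ℚ ≤ flips K j F g t
    0≤flips K j F g t = 0≤sumList (λ ξ → 0≤ind (get t ξ)) (relevant K g)

    0≤tails : ∀ K j F g t → 0ℚ ≤ tails K j F g t
    0≤tails K j F g t = 0≤tailCost (separated j) (randomise F (get t) ∘ point) K (j ℕ.∸ K) g

    E-cost : ∀ {c} K → 0ℚ ≤ c → 1ℚ ≤ c * (ι (offset K) * δ) → ∀ j F g →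
      E j (cost K j F g) ≤ ι (offset K) * δ + c * ½ ^ (1 ℕ.+ K)
    E-cost {c} K 0≤c h j F g = begin
      E j (cost K j F g)                               ≡⟨ E-+ j (flips K j F g) (tails K j F g) ⟩
      E j (flips K j F g) + E j (tails K j F g)
        ≤⟨ +-mono-≤ (E-sumList j (λ ξ t → ind (get t ξ)) δ (E-bit j) (relevant K g)) (E-tailCost {c} K 0≤c h j F (j ℕ.∸ K) g) ⟩
      ι (length (relevant K g)) * δ + c * ½ ^ (1 ℕ.+ K)
        ≤⟨ +-monoˡ-≤ (c * ½ ^ (1 ℕ.+ K)) (*-mono-right (0≤rate n) (ι-mono {length (relevant K g)} {offset K} (length-relevant K g))) ⟩
      ι (offset K) * δ + c * ½ ^ (1 ℕ.+ K)             ∎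
      where open ≤-Reasoning

    -- Suppose that no relevant bit is flipped and no later block is violated. Then level j reduces
    -- to correcting K blocks, the noisy valuation copies the corrected v on all that matters there,
    -- and correcting that again changes nothing.
    agrees : ∀ {K j₀ j} F v g (t : Tree j) → K ℕ.≤ j₀ → Resolved K j₀ g → K ℕ.≤ j → Resolved K j g →
      F g ≡ correctAt j₀ v g → All (λ ξ → F (point ξ) ≡ v (point ξ)) (relevant K g) →
      correctAt j₀ v g ≡ correctAt j (randomise F (get t)) g ⊎ 1ℚ ≤ cost K j F g t
    agrees {K} {j₀} {j} F v g t K≤j₀ res₀ K≤j res Fg Fpoints =
      [ (λ quiet → [ inj₁ ∘ stays quiet , (λ le → inj₂ (≤-trans le (p≤q+p {tails K j F g t} (0≤flips K j F g t)))) ]′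
          (correctAt-≡⊎1≤tailCost {K} {j} {g} K≤j res r))
      , (λ le → inj₂ (≤-trans le (p≤p+q {flips K j F g t} (0≤tails K j F g t)))) ]′
      (All⊎1≤sumList {f = ind ∘ get t} (λ ξ → 0≤ind (get t ξ)) (All.universal (λ ξ → false⊎1≤ind (get t ξ)) (relevant K g)))
      where
      w r : Gen → Bool
      w = correctAt j₀ v
      r = randomise F (get t)
      stays : All (λ ξ → get t ξ ≡ false) (relevant K g) → correctAt j r g ≡ correct distinct K r g → w g ≡ correctAt j r g
      stays quiet eq = sym (trans eq (trans
        (correct-cong distinct K {r} {w} g (randomise-quiet F w (get t) K g Fg quiet)
          (All.zipWith (λ {ξ} (q , Fξ) → trans (cong (F (point ξ) xor_) q) (trans (𝔹.xor-identityʳ (F (point ξ))) Fξ)) (quiet , Fpoints)))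
        (correct-idem (separated j₀) distinct v g K≤j₀ res₀)))

    -- For every tree either φ holds or some generator of φ pays at least 1; take expectations.
    1≤prob+ : ∀ {c} K φ F v {j₀ j} → 0ℚ ≤ c → 1ℚ ≤ c * (ι (offset K) * δ) →
      eval (correctAt j₀ v) φ ≡ true →
      All (λ g → F g ≡ correctAt j₀ v g) (vars φ) →
      All (λ g → All (λ ξ → F (point ξ) ≡ v (point ξ)) (relevant K g)) (vars φ) →
      K ℕ.≤ j₀ → All (Resolved K j₀) (vars φ) → K ℕ.≤ j → All (Resolved K j) (vars φ) →
      1ℚ ≤ prob F φ j + ι (length (vars φ)) * (ι (offset K) * δ + c * ½ ^ (1 ℕ.+ K))
    1≤prob+ {c} K φ F v {j₀} {j} 0≤c h sat fits fits′ K≤j₀ res₀ K≤j res = begin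
      1ℚ                                       ≡⟨ E-const j 1ℚ ⟨
      E j (λ _ → 1ℚ)                           ≤⟨ E-mono j {λ _ → 1ℚ} {λ t → value t + total t} pointwise ⟩
      E j (λ t → value t + total t)            ≡⟨ E-+ j value total ⟩
      prob F φ j + E j total                   ≤⟨ +-monoʳ-≤ (prob F φ j) (E-sumList j (cost K j F) _ (E-cost {c} K 0≤c h j F) (vars φ)) ⟩
      prob F φ j + ι (length (vars φ)) * (ι (offset K) * δ + c * ½ ^ (1 ℕ.+ K)) ∎
      where
      open ≤-Reasoning
      value total : Tree j → ℚ
      value t = ind (eval (correctAt j (randomise F (get t))) φ)
      total t = sumList (λ g → cost K j F g t) (vars φ)
      pointwise : ∀ t → 1ℚ ≤ value t + total t
      pointwise t = subst (λ b → ind b ≤ value t + total t) sat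
        (ind-eval-≤ φ {correctAt j₀ v} {correctAt j (randomise F (get t))} {λ g → cost K j F g t}
          (λ g → 0≤+ (0≤flips K j F g t) (0≤tails K j F g t))
          (All.zipWith (λ {g} → λ { ((Fg , Fpoints) , (r₀ , r)) → agrees F v g t K≤j₀ r₀ K≤j r Fg Fpoints })
            (All.zip (fits , fits′) , All.zip (res₀ , res))))

  measureWith : ℕ × ℕ × ℕ → Measure 𝔅
  measureWith (n , h , s) = Noise.measure n (tableAt h s)

  measureWith-probability : ∀ p → IsProbability 𝔅 (measureWith p)
  measureWith-probability (n , h , s) = Noise.probability n (tableAt h s)

  gap : ℚ
  gap = ½ * (½ * ½)

  0<gap : 0ℚ < gap
  0<gap = *<* (+<+ (ℕ.s≤s ℕ.z≤n))

  prob>½ : ∀ φ K n c F v j₀ → 0ℚ ≤ c → 1ℚ ≤ c * (ι (offset K) * rate n) →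
    ι 8 * (ι (length (vars φ)) * (ι (offset K) * rate n + c * ½ ^ (1 ℕ.+ K))) ≤ 1ℚ + 1ℚ →
    eval (correctAt j₀ v) φ ≡ true →
    All (λ g → F g ≡ correctAt j₀ v g) (vars φ ++ map point (concatMap (relevant K) (vars φ))) →
    K ℕ.≤ j₀ × All (Resolved K j₀) (vars φ) →
    ∀ j → K ℕ.≤ j × All (Resolved K j) (vars φ) → gap < Noise.prob n F φ j - ½
  prob>½ φ K n c F v j₀ 0≤c 1≤cMδ small sat fits (K≤j₀ , res₀) j (K≤j , res) =
    exceeds-½ (Noise.prob n F φ j) (ι (length (vars φ)) * (ι (offset K) * rate n + c * ½ ^ (1 ℕ.+ K)))
      (Concentration.1≤prob+ n {c} K φ F v {j₀} {j} 0≤c 1≤cMδ sat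
        (All.++⁻ˡ (vars φ) fits) fits-points K≤j₀ res₀ K≤j res)
      small
    where
    fits-points : All (λ g → All (λ ξ → F (point ξ) ≡ v (point ξ)) (relevant K g)) (vars φ)
    fits-points = All.map⁻ (All.concat⁻ (All.map⁻ (All.++⁻ʳ (vars φ) fits)))

  exceeds-with : ∀ φ K n c → ¬ (φ ≋ ⟨⊥⟩) → 0ℚ ≤ c → 1ℚ ≤ c * (ι (offset K) * rate n) →
    ι 8 * (ι (length (vars φ)) * (ι (offset K) * rate n + c * ½ ^ (1 ℕ.+ K))) ≤ 1ℚ + 1ℚ →
    ∃[ p ] (½ᴿ <ᴿ Measure.μ (measureWith p) φ)
  exceeds-with φ K n c φ≉⊥ 0≤c 1≤cMδ small = choose (≉⊥⇒satisfied φ φ≉⊥ (proj₁ settled))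
    where
    settled : Eventually λ j → K ℕ.≤ j × All (Resolved K j) (vars φ)
    settled = ev-zip _,_ (from K) (ev-All (resolved K) (vars φ))
    choose : ∃[ j₀ ] (proj₁ settled ℕ.≤ j₀ × ∃[ v ] (eval (correctAt j₀ v) φ ≡ true)) →
      ∃[ p ] (½ᴿ <ᴿ Measure.μ (measureWith p) φ)
    choose (j₀ , J≤j₀ , v , sat) = tabulate (tableAt-fits (correctAt j₀ v) L)
      where
      -- The table must also copy the points in the first K blocks, since they decide whether those
      -- blocks are violated.
      L = vars φ ++ map point (concatMap (relevant K) (vars φ))
      tabulate : ∃[ h ] ∃[ s ] All (λ g → tableAt h s g ≡ correctAt j₀ v g) L →
        ∃[ p ] (½ᴿ <ᴿ Measure.μ (measureWith p) φ)
      tabulate (h , s , fits) = (n , h , s) , gap , 0<gap , proj₁ settled , λ j J≤j →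
        prob>½ φ K n c (tableAt h s) v j₀ 0≤c 1≤cMδ small sat fits (proj₂ settled j₀ J≤j₀) j (proj₂ settled j J≤j)

  exceeds : ∀ φ → ¬ (φ ≋ ⟨⊥⟩) → ∃[ p ] (½ᴿ <ᴿ Measure.μ (measureWith p) φ)
  exceeds φ φ≉⊥ = with-parameters (parameters 8 (length (vars φ)))
    where
    with-parameters : ∃[ K ] ∃[ n ] ∃[ c ] (0ℚ ≤ c × 1ℚ ≤ c * (ι (offset K) * rate n) ×
        ι 8 * (ι (length (vars φ)) * (ι (offset K) * rate n + c * ½ ^ (1 ℕ.+ K))) ≤ 1ℚ + 1ℚ) →
      ∃[ p ] (½ᴿ <ᴿ Measure.μ (measureWith p) φ)
    with-parameters (K , n , c , 0≤c , lower , upper) = exceeds-with φ K n c φ≉⊥ 0≤c lower upper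

  approximable : Approximable 𝔅
  approximable = (λ i → measureWith (unpair₃ i)) , (λ i → measureWith-probability (unpair₃ i)) , λ φ φ≉⊥ → choose φ (exceeds φ φ≉⊥)
    where
    choose : ∀ φ → ∃[ p ] (½ᴿ <ᴿ Measure.μ (measureWith p) φ) → ∃[ i ] (½ᴿ <ᴿ Measure.μ (measureWith (unpair₃ i)) φ)
    choose φ (p , lt) = proj₁ i , subst (λ p → ½ᴿ <ᴿ Measure.μ (measureWith p) φ) (sym (proj₂ i)) lt
      where i = unpair₃-surjective p

-- The order of the reals

infix 4 _≲_

-- A positive form of the weak order: unlike the negation `≤ᴿ`, it can be chained and added term by
-- term.
_≲_ : ℝ → ℝ → Set
x ≲ y = ∀ ε → 0ℚ < ε → Eventually λ n → seq x n < seq y n + ε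

0<½* : ∀ {ε} → 0ℚ < ε → 0ℚ < ½ * ε
0<½* {ε} 0<ε = subst (_< ½ * ε) (*-zeroʳ ½) (*-monoʳ-<-pos ½ 0<ε)

½*+½* : ∀ ε → ½ * ε + ½ * ε ≡ ε
½*+½* = solve 1 (λ e → con ½ :* e :+ con ½ :* e := e) refl
  where open +-*-Solver

p≤∣p∣ : ∀ p → p ≤ ∣ p ∣
p≤∣p∣ p with ≤-total 0ℚ p
... | inj₁ 0≤p = ≤-reflexive (sym (0≤p⇒∣p∣≡p 0≤p))
... | inj₂ p≤0 = ≤-trans p≤0 (0≤∣p∣ p)

p-q<r⇒p<q+r : ∀ p q r → p - q < r → p < q + r
p-q<r⇒p<q+r p q r lt = subst₂ _<_ (solve 2 (λ p q → q :+ (p :- q) := p) refl p q) refl (+-monoʳ-< q lt)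
  where open +-*-Solver

≃-trans : ∀ {x y z} → x ≃ y → y ≃ z → x ≃ z
≃-trans {x} {y} {z} x≃y y≃z ε 0<ε = ev-zip (λ {n} → step (seq x n) (seq y n) (seq z n)) (x≃y (½ * ε) (0<½* 0<ε)) (y≃z (½ * ε) (0<½* 0<ε))
  where
  step : ∀ p q r → ∣ p - q ∣ < ½ * ε → ∣ q - r ∣ < ½ * ε → ∣ p - r ∣ < ε
  step p q r pq qr = begin-strict
    ∣ p - r ∣                  ≡⟨ cong ∣_∣ (solve 3 (λ p q r → p :- r := (p :- q) :+ (q :- r)) refl p q r) ⟩
    ∣ (p - q) + (q - r) ∣      ≤⟨ ∣p+q∣≤∣p∣+∣q∣ (p - q) (q - r) ⟩
    ∣ p - q ∣ + ∣ q - r ∣      <⟨ +-mono-< pq qr ⟩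
    ½ * ε + ½ * ε              ≡⟨ ½*+½* ε ⟩
    ε                          ∎
    where open ≤-Reasoning
          open +-*-Solver

≲-trans : ∀ {x y z} → x ≲ y → y ≲ z → x ≲ z
≲-trans {x} {y} {z} x≲y y≲z ε 0<ε = ev-zip (λ {n} → step (seq x n) (seq y n) (seq z n)) (x≲y (½ * ε) (0<½* 0<ε)) (y≲z (½ * ε) (0<½* 0<ε))
  where
  step : ∀ p q r → p < q + ½ * ε → q < r + ½ * ε → p < r + ε
  step p q r p< q< = begin-strict
    p                       <⟨ p< ⟩
    q + ½ * ε               <⟨ +-monoˡ-< (½ * ε) q< ⟩
    r + ½ * ε + ½ * ε       ≡⟨ +-assoc r (½ * ε) (½ * ε) ⟩
    r + (½ * ε + ½ * ε)     ≡⟨ cong (r +_) (½*+½* ε) ⟩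
    r + ε                   ∎
    where open ≤-Reasoning

≲-+ : ∀ {x y x′ y′} → x ≲ x′ → y ≲ y′ → x +ᴿ y ≲ x′ +ᴿ y′
≲-+ {x} {y} {x′} {y′} x≲ y≲ ε 0<ε = ev-zip (λ {n} → step (seq x n) (seq y n) (seq x′ n) (seq y′ n)) (x≲ (½ * ε) (0<½* 0<ε)) (y≲ (½ * ε) (0<½* 0<ε))
  where
  step : ∀ p q p′ q′ → p < p′ + ½ * ε → q < q′ + ½ * ε → p + q < p′ + q′ + ε
  step p q p′ q′ p< q< = subst (p + q <_)
    (solve 3 (λ a b e → a :+ con ½ :* e :+ (b :+ con ½ :* e) := a :+ b :+ e) refl p′ q′ ε) (+-mono-< p< q<)
    where open +-*-Solver

≤⇒≲ : ∀ {x y} → (∀ n → seq x n ≤ seq y n) → x ≲ y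
≤⇒≲ {x} {y} le ε 0<ε = always λ n → ≤-<-trans (le n) (subst (_< seq y n + ε) (+-identityʳ (seq y n)) (+-monoʳ-< (seq y n) 0<ε))

≃⇒≲ : ∀ {x y} → x ≃ y → x ≲ y
≃⇒≲ {x} {y} x≃y ε 0<ε = ev-map (λ {n} lt → p-q<r⇒p<q+r (seq x n) (seq y n) ε (≤-<-trans (p≤∣p∣ (seq x n - seq y n)) lt)) (x≃y ε 0<ε)

≃⇒≳ : ∀ {x y} → x ≃ y → y ≲ x
≃⇒≳ {x} {y} x≃y ε 0<ε = ev-map (λ {n} lt → p-q<r⇒p<q+r (seq y n) (seq x n) ε
  (≤-<-trans (p≤∣p∣ (seq y n - seq x n)) (subst (_< ε) (∣p-q∣≡∣q-p∣ (seq x n) (seq y n)) lt))) (x≃y ε 0<ε)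
  where
  ∣p-q∣≡∣q-p∣ : ∀ p q → ∣ p - q ∣ ≡ ∣ q - p ∣
  ∣p-q∣≡∣q-p∣ p q = trans (sym (∣-p∣≡∣p∣ (p - q))) (cong ∣_∣ (solve 2 (λ p q → :- (p :- q) := q :- p) refl p q))
    where open +-*-Solver

<ᴿ⇒≲ : ∀ {x y} → x <ᴿ y → x ≲ y
<ᴿ⇒≲ {x} {y} (gap , 0<gap , N , lt) ε 0<ε = N , λ n N≤n → step (seq x n) (seq y n) (<-trans 0<gap (lt n N≤n))
  where
  step : ∀ p q → 0ℚ < q - p → p < q + ε
  step p q 0<q-p = begin-strict
    p              ≡⟨ +-identityʳ p ⟨
    p + 0ℚ         <⟨ +-monoʳ-< p 0<q-p ⟩
    p + (q - p)    ≡⟨ solve 2 (λ p q → p :+ (q :- p) := q :+ con 0ℚ) refl p q ⟩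
    q + 0ℚ         <⟨ +-monoʳ-< q 0<ε ⟩
    q + ε          ∎
    where open ≤-Reasoning
          open +-*-Solver

-- If some late term of x were below -ε, the Cauchy property would keep x below -ε/2.
0≤ᴿ⇒0≲ : ∀ {x} → 0ᴿ ≤ᴿ x → 0ᴿ ≲ x
0≤ᴿ⇒0≲ {x} 0≤x ε 0<ε = proj₁ late , λ n N≤n → decide n N≤n (0ℚ <? seq x n + ε)
  where
  late = cauchy x (½ * ε) (0<½* 0<ε)
  step : ∀ p q → p + ε ≤ 0ℚ → q - p < ½ * ε → ½ * ε < 0ℚ - q
  step p q p+ε≤0 q-p< = begin-strict
    ½ * ε                  ≡⟨ solve 2 (λ q e → con ½ :* e := e :- q :- con ½ :* e :+ q) refl q ε ⟩
    ε - q - ½ * ε + q      <⟨ +-monoʳ-< (ε - q - ½ * ε) (p-q<r⇒p<q+r q p (½ * ε) q-p<) ⟩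
    ε - q - ½ * ε + (p + ½ * ε) ≡⟨ solve 3 (λ p q e → e :- q :- con ½ :* e :+ (p :+ con ½ :* e) := p :+ e :- q) refl p q ε ⟩
    p + ε - q              ≤⟨ +-monoˡ-≤ (- q) p+ε≤0 ⟩
    0ℚ - q                 ∎
    where open ≤-Reasoning
          open +-*-Solver
  decide : ∀ n → proj₁ late ℕ.≤ n → Dec (0ℚ < seq x n + ε) → 0ℚ < seq x n + ε
  decide n N≤n (yes lt) = lt
  decide n N≤n (no ≮)   = ⊥-elim (0≤x (½ * ε , 0<½* 0<ε , proj₁ late , λ m N≤m → step (seq x n) (seq x m) (≮⇒≥ ≮)
    (≤-<-trans (p≤∣p∣ (seq x m - seq x n)) (proj₂ late m n N≤m N≤n))))

positive⇒≴½^ : ∀ {x} → 0ᴿ <ᴿ x → ¬ (∀ k → x ≲ fromℚ (½ ^ k))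
positive⇒≴½^ {x} (ε , 0<ε , N , lt) small = <-irrefl {seq x M} refl (<-trans {seq x M} {ε}
    (subst (seq x M <_) (½*+½* ε) (<-trans (proj₂ below M (ℕ.m≤n⊔m N (proj₁ below))) (+-monoˡ-< (½ * ε) (proj₂ k))))
    (subst (ε <_) (p-0≡p (seq x M)) (lt M (ℕ.m≤m⊔n N (proj₁ below)))))
  where
  k = ½^-small (0<½* 0<ε)
  below = small (proj₁ k) (½ * ε) (0<½* 0<ε)
  -- Both estimates hold at this index: the term exceeds ε and yet lies below `½ * ε + ½ * ε`.
  M = N ℕ.⊔ proj₁ below
  p-0≡p : ∀ p → p - 0ℚ ≡ p
  p-0≡p p = +-identityʳ p

0ᴿ<fromℚ : ∀ {q} → 0ℚ < q → 0ᴿ <ᴿ fromℚ q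
0ᴿ<fromℚ {q} 0<q = ½ * q , 0<½* 0<q , 0 , λ _ _ → (begin-strict
  ½ * q        <⟨ *-monoˡ-<-pos q ⦃ positive 0<q ⦄ ½<1 ⟩
  1ℚ * q       ≡⟨ *-identityˡ q ⟩
  q            ≡⟨ +-identityʳ q ⟨
  q - 0ℚ       ∎)
  where open ≤-Reasoning

-- Nonseparability

-- The stream returned past the end is a dummy: blocks are rebuilt from positions within the length
-- only, and the diagonal argument just avoids one stream more.
nth : List Stream → ℕ → Stream
nth []      _       = λ _ → false
nth (ξ ∷ D) zero    = ξ
nth (ξ ∷ D) (suc i) = nth D i

applyUpTo-nth : ∀ D → applyUpTo (nth D) (length D) ≡ D
applyUpTo-nth []      = refl
applyUpTo-nth (ξ ∷ D) = cong (ξ ∷_) (applyUpTo-nth D)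

∈⇒nth : ∀ {ξ D} → ξ ∈ D → ∃[ i ] (nth D i ≡ ξ)
∈⇒nth (here refl) = 0 , refl
∈⇒nth (there ξ∈D) = suc (proj₁ (∈⇒nth ξ∈D)) , proj₂ (∈⇒nth ξ∈D)

b≢not-b : ∀ b → b ≢ not b
b≢not-b true  ()
b≢not-b false ()

-- Cantor's diagonal argument.
not-enumerated : ∀ (D : ℕ → List Stream) → ¬ (∀ ξ → ∃[ n ] (ξ ∈ D n))
not-enumerated D covers = escape (covers diagonal)
  where
  diagonal : Stream
  diagonal i = not (nth (D (proj₁ (unpair i))) (proj₂ (unpair i)) i)
  escape : ¬ (∃[ n ] (diagonal ∈ D n))
  escape (n , ∈Dn) = b≢not-b (diagonal i) (trans
    (cong (λ p → not (nth (D (proj₁ p)) (proj₂ p) i)) (proj₂ index))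
    (cong (λ ξ → not (ξ i)) (proj₂ (∈⇒nth ∈Dn))))
    where
    index = unpair-surjective n (proj₁ (∈⇒nth ∈Dn))
    i = proj₁ index

all-false : ∀ (x : Stream → Bool) {D} → All (λ ξ → x ξ ≡ false) D → all (not ∘ x) D ≡ true
all-false x []         = refl
all-false x (eq ∷ eqs) = cong₂ _∧_ (cong not eq) (all-false x eqs)

all-true : ∀ (x : Stream → Bool) {D} → All (λ ξ → x ξ ≡ true) D → all x D ≡ true
all-true x []         = refl
all-true x (eq ∷ eqs) = cong₂ _∧_ eq (all-true x eqs)

isConstant-≡ : ∀ (x : Stream → Bool) b {D} → All (λ ξ → x ξ ≡ b) D → isConstant x D ≡ true
isConstant-≡ x true  {D} eqs = cong (_∨ all (not ∘ x) D) (all-true x eqs)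
isConstant-≡ x false {D} eqs = trans (cong (all x D ∨_) (all-false x eqs)) (𝔹.∨-zeroʳ (all x D))

module Nonseparability (em : ExcludedMiddle 0ℓ) (ext : Extensionality 0ℓ 0ℓ) where

  open Measures em ext

  -- Grow a list inside each class of c. If every class ran out before reaching m entries, countably
  -- many finite lists would exhaust all streams, against the diagonal argument.
  pigeonhole : ∀ (c : Stream → ℕ) m → ∃[ n ] ∃[ D ] (length D ≡ m × AllPairs _≢_ D × All (λ ξ → c ξ ≡ n) D)
  pigeonhole c m = conclude (em {∃[ n ] ∃[ D ] (length D ≡ m × AllPairs _≢_ D × All (λ ξ → c ξ ≡ n) D)})
    where
    grow : ∀ n m → (∃[ D ] (length D ≡ m × AllPairs _≢_ D × All (λ ξ → c ξ ≡ n) D)) ⊎ (∃[ D ] (∀ ξ → c ξ ≡ n → ξ ∈ D))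
    grow n zero = inj₁ ([] , refl , [] , [])
    grow n (suc m) with grow n m
    ... | inj₂ complete = inj₂ complete
    ... | inj₁ (D , len , ≢s , cs) with em {∃[ ξ ] (c ξ ≡ n × ¬ (ξ ∈ D))}
    ... | yes (ξ , cξ , ξ∉D) = inj₁ (ξ ∷ D , cong suc len , All.tabulate (λ { η∈D refl → ξ∉D η∈D }) ∷ ≢s , cξ ∷ cs)
    ... | no none = inj₂ (D , λ ξ cξ → decidable-stable em λ ξ∉D → none (ξ , cξ , ξ∉D))
    conclude : Dec (∃[ n ] ∃[ D ] (length D ≡ m × AllPairs _≢_ D × All (λ ξ → c ξ ≡ n) D)) → _
    conclude (yes found) = found
    conclude (no none) = ⊥-elim (not-enumerated (λ n → proj₁ (complete n)) λ ξ → c ξ , proj₂ (complete (c ξ)) ξ refl)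
      where
      complete : ∀ n → ∃[ D ] (∀ ξ → c ξ ≡ n → ξ ∈ D)
      complete n = [ (λ found → ⊥-elim (none (n , found))) , (λ D → D) ]′ (grow n m)

  ≢⇒separated : ∀ {D} → AllPairs _≢_ D → ∃[ j ] AllPairs (Sep j) D
  ≢⇒separated {D} ≢s = proj₁ ev , AllPairs.zipWith (λ { (ne , inj₁ eq) → contradiction eq ne ; (ne , inj₂ sep) → sep }) (≢s , proj₂ ev (proj₁ ev) ℕ.≤-refl)
    where ev = ev-AllPairs (≡⊎Sep em ext) D

  -- With fair bits, the total probability of a violation is at most a half.
  family≉⊥ : ∀ T → ¬ (var (family T) ≋ ⟨⊥⟩)
  family≉⊥ T (J , vanishes) = <-irrefl {1ℚ} refl (begin-strict
      1ℚ                                          ≡⟨ E-const J 1ℚ ⟨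
      E J (λ _ → 1ℚ)                              ≤⟨ E-mono J {λ _ → 1ℚ} {cost} pointwise ⟩
      E J cost                                    ≤⟨ E-tailCost {1ℚ} 0 0≤1 1≤2δ J (λ _ → true) (J ℕ.∸ 0) (family T) ⟩
      1ℚ * ½ ^ 1                                  <⟨ *<* (+<+ (ℕ.s≤s (ℕ.s≤s ℕ.z≤n))) ⟩
      1ℚ                                          ∎)
    where
    open ≤-Reasoning
    open Noise 0
    -- The initial value 2 of `offset` is what lets fair bits satisfy the hypothesis of `E-tailCost`
    -- with K = 0 and c = 1.
    1≤2δ : 1ℚ ≤ 1ℚ * (ι 2 * rate 0)
    1≤2δ = ≤-reflexive (sym (trans (*-identityˡ (ι 2 * rate 0)) (ι*rate 0)))
    v : Tree J → Gen → Bool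
    v t = randomise (λ _ → true) (get t)
    cost : Tree J → ℚ
    cost t = tailCost (separated J) (v t ∘ point) 0 (J ℕ.∸ 0) (family T)
    pointwise : ∀ t → 1ℚ ≤ cost t
    -- With no block corrected the family is true, but at level J it is assumed false, so every tree
    -- must violate some block.
    pointwise t = [ (λ eq → contradiction (trans (sym (vanishes J ℕ.≤-refl (v t))) eq) λ ()) , (λ le → le) ]′
      (correctAt-≡⊎1≤tailCost {0} {J} {family T} ℕ.z≤n (λ _ _ _ ()) (v t))

  infix 4 _⊑_

  _⊑_ : Formula → Formula → Set
  φ ⊑ ψ = Eventually λ j → ∀ v → eval (correctAt j v) φ ≡ true → eval (correctAt j v) ψ ≡ true

  _⟨△⟩_ : Formula → Formula → Formula
  φ ⟨△⟩ ψ = (φ ⟨∧⟩ ⟨¬⟩ ψ) ⟨∨⟩ (ψ ⟨∧⟩ ⟨¬⟩ φ)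

  someDiffer : Formula → List Stream → Formula
  someDiffer φ []      = ⟨⊥⟩
  someDiffer φ (ξ ∷ D) = (var (point ξ) ⟨△⟩ φ) ⟨∨⟩ someDiffer φ D

  someDiffer-false : ∀ v φ D → eval v (someDiffer φ D) ≡ false → All (λ ξ → v (point ξ) ≡ eval v φ) D
  someDiffer-false v φ []      _  = []
  someDiffer-false v φ (ξ ∷ D) eq = proj₁ (agree (v (point ξ)) (eval v φ) eq) ∷ someDiffer-false v φ D (proj₂ (agree (v (point ξ)) (eval v φ) eq))
    where
    agree : ∀ a b {c} → ((a ∧ not b) ∨ (b ∧ not a)) ∨ c ≡ false → a ≡ b × c ≡ false
    agree true  true  eq = refl , eq
    agree false false eq = refl , eq

  -- If no point of the block differed from φ, they would all share its value and the block would be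
  -- constant. From level k + 1 on the block is examined, and from level i on it is separated, so
  -- the family would be false.
  family⊑someDiffer : ∀ T k → ∃[ i ] AllPairs (Sep i) (block T k) → ∀ φ → var (family T) ⊑ someDiffer φ (block T k)
  family⊑someDiffer T k (i , sep) φ = ev-zip (λ {j} → below {j}) (from (suc k)) (from i)
    where
    below : ∀ {j} → suc k ℕ.≤ j → i ℕ.≤ j → ∀ v → correctAt j v (family T) ≡ true → eval (correctAt j v) (someDiffer φ (block T k)) ≡ true
    below {j} k<j i≤j v sat = 𝔹.¬-not λ none → contradiction
      (trans (sym (cong₂ _∧_ separated-true (isConstant-≡ (v ∘ point) _ (someDiffer-false (correctAt j v) φ (block T k) none))))
        (anyBelow-false j (unviolated (v (family T)) _ sat) k k<j)) λ ()
      where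
      separated-true : separated j (block T k) ≡ true
      separated-true with em {AllPairs (Sep j) (block T k)}
      ... | yes _ = refl
      ... | no ¬s = contradiction (AllPairs.map (Sep-mono i≤j) sep) ¬s
      unviolated : ∀ a b → a ∧ not b ≡ true → b ≡ false
      unviolated true false _ = refl

  -- Estimates for an arbitrary measure on the algebra

  module _ (ν : Measure 𝔅) where

    open Measure ν

    -- The common source of monotonicity (χ = ψ) and of subadditivity (ψ the join of φ and χ).
    μ-split : ∀ {φ ψ χ} → ψ ≋ φ ⟨∨⟩ (χ ⟨∧⟩ ⟨¬⟩ φ) → μ ψ ≃ μ φ +ᴿ μ (χ ⟨∧⟩ ⟨¬⟩ φ)
    μ-split {φ} {ψ} {χ} eq = ≃-trans {μ ψ} {μ (φ ⟨∨⟩ (χ ⟨∧⟩ ⟨¬⟩ φ))} {μ φ +ᴿ μ (χ ⟨∧⟩ ⟨¬⟩ φ)} (μ-cong eq)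
      (μ-add φ (χ ⟨∧⟩ ⟨¬⟩ φ) (tautology {φ ⟨∧⟩ χ ⟨∧⟩ ⟨¬⟩ φ} {⟨⊥⟩} λ v → disjoint (eval v φ) (eval v χ)))
      where
      disjoint : ∀ a b → a ∧ b ∧ not a ≡ false
      disjoint true  b = 𝔹.∧-zeroʳ b
      disjoint false b = refl

    μ-mono : ∀ {φ ψ} → φ ⊑ ψ → μ φ ≲ μ ψ
    μ-mono {φ} {ψ} φ⊑ψ = ≲-trans {μ φ} {μ φ +ᴿ μ (ψ ⟨∧⟩ ⟨¬⟩ φ)} {μ ψ}
      (≲-trans {μ φ} {μ φ +ᴿ 0ᴿ} {μ φ +ᴿ μ (ψ ⟨∧⟩ ⟨¬⟩ φ)}
        (≤⇒≲ {μ φ} {μ φ +ᴿ 0ᴿ} λ n → ≤-reflexive (sym (+-identityʳ (seq (μ φ) n))))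
        (≲-+ {μ φ} {0ᴿ} {μ φ} {μ (ψ ⟨∧⟩ ⟨¬⟩ φ)} (≤⇒≲ {μ φ} {μ φ} λ n → ≤-refl) (0≤ᴿ⇒0≲ {μ (ψ ⟨∧⟩ ⟨¬⟩ φ)} (μ-nonneg (ψ ⟨∧⟩ ⟨¬⟩ φ)))))
      (≃⇒≳ {μ ψ} {μ φ +ᴿ μ (ψ ⟨∧⟩ ⟨¬⟩ φ)} (μ-split {φ} {ψ} {ψ} (ev-map (λ {j} le v → union (eval (correctAt j v) φ) (eval (correctAt j v) ψ) (le v)) φ⊑ψ)))
      where
      union : ∀ a b → (a ≡ true → b ≡ true) → b ≡ a ∨ b ∧ not a
      union true  b le = le refl
      union false b le = sym (𝔹.∧-identityʳ b)

    μ-∨ : ∀ φ ψ → μ (φ ⟨∨⟩ ψ) ≲ μ φ +ᴿ μ ψ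
    μ-∨ φ ψ = ≲-trans {μ (φ ⟨∨⟩ ψ)} {μ φ +ᴿ μ (ψ ⟨∧⟩ ⟨¬⟩ φ)} {μ φ +ᴿ μ ψ}
      (≃⇒≲ {μ (φ ⟨∨⟩ ψ)} {μ φ +ᴿ μ (ψ ⟨∧⟩ ⟨¬⟩ φ)} (μ-split {φ} {φ ⟨∨⟩ ψ} {ψ}
        (tautology {φ ⟨∨⟩ ψ} {φ ⟨∨⟩ (ψ ⟨∧⟩ ⟨¬⟩ φ)} λ v → union (eval v φ) (eval v ψ))))
      (≲-+ {μ φ} {μ (ψ ⟨∧⟩ ⟨¬⟩ φ)} {μ φ} {μ ψ} (≤⇒≲ {μ φ} {μ φ} λ n → ≤-refl)
        (μ-mono {ψ ⟨∧⟩ ⟨¬⟩ φ} {ψ} (always λ j v → conj (eval (correctAt j v) ψ))))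
      where
      union : ∀ a b → a ∨ b ≡ a ∨ b ∧ not a
      union true  b = refl
      union false b = sym (𝔹.∧-identityʳ b)
      conj : ∀ a {b} → a ∧ b ≡ true → a ≡ true
      conj true _ = refl

    -- Bottom is disjoint from itself, so additivity makes its measure equal to its own double.
    μ-⊥ : μ ⟨⊥⟩ ≲ 0ᴿ
    μ-⊥ ε 0<ε = ev-map (λ {n} → cancel (seq (μ ⟨⊥⟩) n)) (≃⇒≳ {μ ⟨⊥⟩} {μ ⟨⊥⟩ +ᴿ μ ⟨⊥⟩} double ε 0<ε)
      where
      double : μ ⟨⊥⟩ ≃ μ ⟨⊥⟩ +ᴿ μ ⟨⊥⟩
      double = ≃-trans {μ ⟨⊥⟩} {μ (⟨⊥⟩ ⟨∨⟩ ⟨⊥⟩)} {μ ⟨⊥⟩ +ᴿ μ ⟨⊥⟩}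
        (μ-cong {⟨⊥⟩} {⟨⊥⟩ ⟨∨⟩ ⟨⊥⟩} (always λ _ _ → refl)) (μ-add ⟨⊥⟩ ⟨⊥⟩ (always λ _ _ → refl))
      +-cancelˡ-< : ∀ p {q r} → p + q < p + r → q < r
      +-cancelˡ-< p {q} {r} lt = subst₂ _<_ (drop q) (drop r) (+-monoʳ-< (- p) lt)
        where
        open +-*-Solver
        drop : ∀ q → - p + (p + q) ≡ q
        drop q = solve 2 (λ p q → :- p :+ (p :+ q) := q) refl p q
      cancel : ∀ p → p + p < p + ε → p < 0ℚ + ε
      cancel p lt = subst (p <_) (sym (+-identityˡ ε)) (+-cancelˡ-< p lt)

    μ-someDiffer : ∀ φ e D → All (λ ξ → μ (var (point ξ) ⟨△⟩ φ) ≲ fromℚ e) D → μ (someDiffer φ D) ≲ fromℚ (ι (length D) * e)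
    μ-someDiffer φ e [] [] = ≲-trans {μ ⟨⊥⟩} {0ᴿ} {fromℚ (0ℚ * e)} μ-⊥ (≤⇒≲ {0ᴿ} {fromℚ (0ℚ * e)} λ _ → ≤-reflexive (sym (*-zeroˡ e)))
    μ-someDiffer φ e (ξ ∷ D) (le ∷ les) =
      ≲-trans {μ (α ⟨∨⟩ β)} {μ α +ᴿ μ β} {z} (μ-∨ α β)
        (≲-trans {μ α +ᴿ μ β} {fromℚ e +ᴿ fromℚ (ι (length D) * e)} {z}
          (≲-+ {μ α} {μ β} {fromℚ e} {fromℚ (ι (length D) * e)} le (μ-someDiffer φ e D les))
          (≤⇒≲ {fromℚ e +ᴿ fromℚ (ι (length D) * e)} {z} λ _ → ≤-reflexive
            (solve 2 (λ e i → e :+ i :* e := (con 1ℚ :+ i) :* e) refl e (ι (length D)))))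
      where
      open +-*-Solver
      α = var (point ξ) ⟨△⟩ φ
      β = someDiffer φ D
      z = fromℚ (ι (length (ξ ∷ D)) * e)

    module _ (d : ℕ → Formula) (dense : ∀ φ ε → 0ᴿ <ᴿ ε → ∃[ n ] (dist 𝔅 ν φ (d n) <ᴿ ε)) where

      -- Small enough that `blockSize k` symmetric differences of this measure add up to at most
      -- `½ ^ k`, by `ι*½^-+≤`.
      radius : ℕ → ℚ
      radius k = ½ ^ (blockSize k ℕ.+ k)

      nearest : ∀ k ξ → ∃[ n ] (dist 𝔅 ν (var (point ξ)) (d n) <ᴿ fromℚ (radius k))
      nearest k ξ = dense (var (point ξ)) (fromℚ (radius k)) (0ᴿ<fromℚ (0<½^ (blockSize k ℕ.+ k)))

      cluster : ∀ k → ∃[ n ] ∃[ D ] (length D ≡ blockSize k × AllPairs _≢_ D × All (λ ξ → proj₁ (nearest k ξ) ≡ n) D)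
      cluster k = pigeonhole (λ ξ → proj₁ (nearest k ξ)) (blockSize k)

      clusters : ℕ → ℕ → Stream
      clusters k = nth (proj₁ (proj₂ (cluster k)))

      block-clusters : ∀ k → block clusters k ≡ proj₁ (proj₂ (cluster k))
      block-clusters k = trans (cong (applyUpTo (clusters k)) (sym (proj₁ (proj₂ (proj₂ (cluster k))))))
        (applyUpTo-nth (proj₁ (proj₂ (cluster k))))

      μ-clusters : ∀ k → μ (var (family clusters)) ≲ fromℚ (½ ^ k)
      μ-clusters k = ≲-trans {μ (var (family clusters))} {μ (someDiffer (d n) D)} {fromℚ (½ ^ k)}
        (μ-mono {var (family clusters)} {someDiffer (d n) D}
          (subst (λ D → var (family clusters) ⊑ someDiffer (d n) D) (block-clusters k)
            (family⊑someDiffer clusters k (subst (λ D → ∃[ j ] AllPairs (Sep j) D) (sym (block-clusters k)) (≢⇒separated ≢s)) (d n))))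
        (≲-trans {μ (someDiffer (d n) D)} {fromℚ (ι (length D) * radius k)} {fromℚ (½ ^ k)}
          (μ-someDiffer (d n) (radius k) D (All.map (λ {ξ} → close ξ) same))
          (≤⇒≲ {fromℚ (ι (length D) * radius k)} {fromℚ (½ ^ k)} λ _ →
            subst (λ m → ι m * radius k ≤ ½ ^ k) (sym len) (ι*½^-+≤ (blockSize k) k)))
        where
        n = proj₁ (cluster k)
        D = proj₁ (proj₂ (cluster k))
        len = proj₁ (proj₂ (proj₂ (cluster k)))
        ≢s = proj₁ (proj₂ (proj₂ (proj₂ (cluster k))))
        same = proj₂ (proj₂ (proj₂ (proj₂ (cluster k))))
        close : ∀ ξ → proj₁ (nearest k ξ) ≡ n → μ (var (point ξ) ⟨△⟩ d n) ≲ fromℚ (radius k)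
        close ξ eq = <ᴿ⇒≲ {μ (var (point ξ) ⟨△⟩ d n)} {fromℚ (radius k)}
          (subst (λ n → dist 𝔅 ν (var (point ξ)) (d n) <ᴿ fromℚ (radius k)) eq (proj₂ (nearest k ξ)))

  nonseparable : ¬ (Σ[ ν ∈ Measure 𝔅 ] (StrictlyPositive 𝔅 ν × Separable 𝔅 ν))
  nonseparable (ν , positive , d , dense) = positive⇒≴½^ {Measure.μ ν (var (family (clusters ν d dense)))}
    (positive (var (family (clusters ν d dense))) (family≉⊥ (clusters ν d dense)))
    (μ-clusters ν d dense)

theorem4p4 : (∀ {ℓ} → ExcludedMiddle ℓ) →
    (∀ {a b} → Extensionality a b) →
    Σ[ 𝔅 ∈ BooleanAlgebra 0ℓ 0ℓ ]
    (Approximable 𝔅 ×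
    ¬ (Σ[ ν ∈ Measure 𝔅 ] (StrictlyPositive 𝔅 ν × Separable 𝔅 ν)))
theorem4p4 em ext = Construction.𝔅 em , Approximability.approximable em ext , Nonseparability.nonseparable em ext
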